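{- Let $r$ be a complex number such that $r^2\in\mathbb{Q}\setminus\{0\}$. Then $\cos r$ is irrational, i.e. $\cos r\notin\mathbb{Q}$.
   Context: Here $\cos$ is the usual (complex) cosine function, with argument in radians. The rational number $r^2$ is allowed to be negative, in which case $r$ is purely imaginary; so $r$ is either real or purely imaginary, and $\cos r$ is real in both cases. -}

module Defs where

open import Data.Nat.Base as ℕ using (ℕ; zero; suc; _!)
import Data.Nat.Properties as ℕ
open import Data.Integer.Base as ℤ using (ℤ; +_; -[1+_]; -1ℤ)
import Data.Integer.Properties as ℤ
open import Data.Rational.Unnormalised.Base as ℚᵘ using (mkℚᵘ; *≡*)
import Data.Rational.Unnormalised.Properties as ℚᵘ
open import Data.Rational.Base as ℚ using (ℚ; 0ℚ; 1ℚ; ½; ∣_∣; fromℚᵘ; toℚᵘ)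
import Data.Rational.Properties as ℚ
open import Data.Rational.Solver using (module +-*-Solver)
open import Data.Product.Base using (∃; _×_; _,_; proj₁; proj₂)
open import Data.Sum.Base using (_⊎_; inj₁; inj₂)
open import Relation.Nullary.Negation using (¬_)
open import Relation.Binary.PropositionalEquality
  using (_≡_; refl; sym; trans; cong; cong₂; subst; subst₂)

open +-*-Solver using (solve; con; _:=_; _:+_; _:*_; _:-_; :-_)

dist : ℚ → ℚ → ℚ
dist p q = ∣ p ℚ.- q ∣

dist-sym : ∀ p q → dist p q ≡ dist q p
dist-sym p q = trans (cong ∣_∣ eq) (ℚ.∣-p∣≡∣p∣ (q ℚ.- p))
  where
  eq : p ℚ.- q ≡ ℚ.- (q ℚ.- p)
  eq = solve 2 (λ a b → a :- b := :- (b :- a)) refl p q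

dist-triangle : ∀ p q r → dist p r ℚ.≤ dist p q ℚ.+ dist q r
dist-triangle p q r =
  subst (λ s → ∣ s ∣ ℚ.≤ dist p q ℚ.+ dist q r) eq
    (ℚ.∣p+q∣≤∣p∣+∣q∣ (p ℚ.- q) (q ℚ.- r))
  where
  eq : (p ℚ.- q) ℚ.+ (q ℚ.- r) ≡ p ℚ.- r
  eq = solve 3 (λ a b c → (a :- b) :+ (b :- c) := a :- c)
         refl p q r

0<½ : 0ℚ ℚ.< ½
0<½ = ℚ.positive⁻¹ ½

0<1 : 0ℚ ℚ.< 1ℚ
0<1 = ℚ.positive⁻¹ 1ℚ

0≤1 : 0ℚ ℚ.≤ 1ℚ
0≤1 = ℚ.<⇒≤ 0<1

pos* : ∀ {p q} → 0ℚ ℚ.< p → 0ℚ ℚ.< q → 0ℚ ℚ.< p ℚ.* q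
pos* {p} {q} 0<p 0<q =
  ℚ.positive⁻¹ _ {{ℚ.pos*pos⇒pos p {{ℚ.positive 0<p}} q {{ℚ.positive 0<q}}}}

nonNeg* : ∀ {p q} → 0ℚ ℚ.≤ p → 0ℚ ℚ.≤ q → 0ℚ ℚ.≤ p ℚ.* q
nonNeg* {p} {q} 0≤p 0≤q =
  ℚ.nonNegative⁻¹ _
    {{ℚ.nonNeg*nonNeg⇒nonNeg p {{ℚ.nonNegative 0≤p}} q {{ℚ.nonNegative 0≤q}}}}

monoˡ : ∀ {p q} r → 0ℚ ℚ.≤ r → p ℚ.≤ q → r ℚ.* p ℚ.≤ r ℚ.* q
monoˡ r 0≤r = ℚ.*-monoˡ-≤-nonNeg r {{ℚ.nonNegative 0≤r}}

monoʳ : ∀ {p q} r → 0ℚ ℚ.≤ r → p ℚ.≤ q → p ℚ.* r ℚ.≤ q ℚ.* r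
monoʳ r 0≤r = ℚ.*-monoʳ-≤-nonNeg r {{ℚ.nonNegative 0≤r}}

mono* : ∀ {p q r s} → 0ℚ ℚ.≤ r → 0ℚ ℚ.≤ q →
        p ℚ.≤ q → r ℚ.≤ s → p ℚ.* r ℚ.≤ q ℚ.* s
mono* {q = q} {r} 0≤r 0≤q p≤q r≤s =
  ℚ.≤-trans (monoʳ r 0≤r p≤q) (monoˡ q 0≤q r≤s)

≤+ʳ : ∀ {p q} → 0ℚ ℚ.≤ q → p ℚ.≤ p ℚ.+ q
≤+ʳ {p} {q} 0≤q = subst (ℚ._≤ p ℚ.+ q) (ℚ.+-identityʳ p) (ℚ.+-monoʳ-≤ p 0≤q)

≤+ˡ : ∀ {p q} → 0ℚ ℚ.≤ p → q ℚ.≤ p ℚ.+ q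
≤+ˡ {p} {q} 0≤p = subst (ℚ._≤ p ℚ.+ q) (ℚ.+-identityˡ q) (ℚ.+-monoˡ-≤ q 0≤p)

nonNeg+ : ∀ {p q} → 0ℚ ℚ.≤ p → 0ℚ ℚ.≤ q → 0ℚ ℚ.≤ p ℚ.+ q
nonNeg+ 0≤p 0≤q = ℚ.≤-trans 0≤p (≤+ʳ 0≤q)

half : ℚ → ℚ
half ε = ε ℚ.* ½

half-pos : ∀ {ε} → 0ℚ ℚ.< ε → 0ℚ ℚ.< half ε
half-pos 0<ε = pos* 0<ε 0<½

half+half : ∀ ε → half ε ℚ.+ half ε ≡ ε
half+half ε = trans (sym (ℚ.*-distribˡ-+ ε ½ ½)) (ℚ.*-identityʳ ε)

<-halves : ∀ {p q ε} → p ℚ.< half ε → q ℚ.< half ε → p ℚ.+ q ℚ.< ε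
<-halves {ε = ε} p< q< = subst (_ ℚ.<_) (half+half ε) (ℚ.+-mono-< p< q<)

via : ∀ p r q {ε} → dist p r ℚ.< half ε → dist r q ℚ.< half ε → dist p q ℚ.< ε
via p r q pr rq = ℚ.≤-<-trans (dist-triangle p r q) (<-halves pr rq)

ι : ℕ → ℚ
ι n = + n ℚ./ 1

fromℚᵘ-homo-* : ∀ p q → fromℚᵘ p ℚ.* fromℚᵘ q ≡ fromℚᵘ (p ℚᵘ.* q)
fromℚᵘ-homo-* p q = ℚ.toℚᵘ-injective
  (ℚᵘ.≃-trans (ℚ.toℚᵘ-homo-* (fromℚᵘ p) (fromℚᵘ q))
    (ℚᵘ.≃-trans (ℚᵘ.*-cong (ℚ.toℚᵘ-fromℚᵘ p) (ℚ.toℚᵘ-fromℚᵘ q))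
      (ℚᵘ.≃-sym (ℚ.toℚᵘ-fromℚᵘ (p ℚᵘ.* q)))))

fromℚᵘ-homo-+ : ∀ p q → fromℚᵘ p ℚ.+ fromℚᵘ q ≡ fromℚᵘ (p ℚᵘ.+ q)
fromℚᵘ-homo-+ p q = ℚ.toℚᵘ-injective
  (ℚᵘ.≃-trans (ℚ.toℚᵘ-homo-+ (fromℚᵘ p) (fromℚᵘ q))
    (ℚᵘ.≃-trans (ℚᵘ.+-cong (ℚ.toℚᵘ-fromℚᵘ p) (ℚ.toℚᵘ-fromℚᵘ q))
      (ℚᵘ.≃-sym (ℚ.toℚᵘ-fromℚᵘ (p ℚᵘ.+ q)))))

ι-suc : ∀ n → ι (suc n) ≡ 1ℚ ℚ.+ ι n
ι-suc n = sym (trans (fromℚᵘ-homo-+ (mkℚᵘ (+ 1) 0) (mkℚᵘ (+ n) 0))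
  (ℚ.fromℚᵘ-cong {mkℚᵘ (+ 1) 0 ℚᵘ.+ mkℚᵘ (+ n) 0} {mkℚᵘ (+ suc n) 0}
    (*≡* (cong (ℤ._* + 1) (cong (ℤ._+_ (+ 1)) (ℤ.*-identityʳ (+ n)))))))

ι-nonNeg : ∀ n → 0ℚ ℚ.≤ ι n
ι-nonNeg zero    = ℚ.≤-refl
ι-nonNeg (suc n) = subst (0ℚ ℚ.≤_) (sym (ι-suc n)) (nonNeg+ 0≤1 (ι-nonNeg n))

1≤ι-suc : ∀ n → 1ℚ ℚ.≤ ι (suc n)
1≤ι-suc n = subst (1ℚ ℚ.≤_) (sym (ι-suc n)) (≤+ʳ (ι-nonNeg n))

ι-mono : ∀ {m n} → m ℕ.≤ n → ι m ℚ.≤ ι n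
ι-mono {n = n} ℕ.z≤n = ι-nonNeg n
ι-mono (ℕ.s≤s {m} {n} m≤n) =
  subst₂ ℚ._≤_ (sym (ι-suc m)) (sym (ι-suc n)) (ℚ.+-monoʳ-≤ 1ℚ (ι-mono m≤n))

ceil : ∀ p → ∃ λ N → p ℚ.≤ ι N
ceil p@(ℚ.mkℚ (+ n) d-1 _) = n , ℚ.toℚᵘ-cancel-≤
  (ℚᵘ.≤-respʳ-≃ (ℚᵘ.≃-sym (ℚ.toℚᵘ-fromℚᵘ (mkℚᵘ (+ n) 0)))
    (ℚᵘ.*≤* (ℤ.*-monoˡ-≤-nonNeg (+ n) (ℤ.+≤+ (ℕ.s≤s ℕ.z≤n)))))
ceil p@(ℚ.mkℚ -[1+ n ] d-1 _) = 0 , ℚ.<⇒≤ (ℚ.negative⁻¹ p)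

archimedes : ∀ C {ε} → 0ℚ ℚ.< ε → ∃ λ N → C ℚ.< ι N ℚ.* ε
archimedes C {ε} 0<ε = suc N , bound
  where
  instance
    ε≢0 = ℚ.>-nonZero 0<ε
  N = proj₁ (ceil (C ℚ.* ℚ.1/ ε))
  C≤ : C ℚ.≤ ι N ℚ.* ε
  C≤ = subst (ℚ._≤ ι N ℚ.* ε)
    (trans (ℚ.*-assoc C (ℚ.1/ ε) ε)
      (trans (cong (C ℚ.*_) (ℚ.*-inverseˡ ε)) (ℚ.*-identityʳ C)))
    (monoʳ ε (ℚ.<⇒≤ 0<ε) (proj₂ (ceil (C ℚ.* ℚ.1/ ε))))
  eq : ε ℚ.+ ι N ℚ.* ε ≡ ι (suc N) ℚ.* ε
  eq = trans (solve 2 (λ e i → e :+ i :* e := (con 1ℚ :+ i) :* e)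
                refl ε (ι N))
             (cong (ℚ._* ε) (sym (ι-suc N)))
  bound : C ℚ.< ι (suc N) ℚ.* ε
  bound = subst₂ ℚ._<_ (ℚ.+-identityˡ C) eq (ℚ.+-mono-<-≤ 0<ε C≤)

Halving : ℕ → (ℕ → ℚ) → Set
Halving K t = ∀ k → K ℕ.≤ k → t (suc k) ℚ.+ t (suc k) ℚ.≤ t k

-- k · t k is eventually nonincreasing, hence t tends to 0.
halving→0 : ∀ K t → (∀ k → 0ℚ ℚ.≤ t k) → Halving K t →
            ∀ ε → 0ℚ ℚ.< ε → ∃ λ N → K ℕ.≤ N × (∀ k → N ℕ.≤ k → t k ℚ.< ε)
halving→0 K t t≥0 t-halving ε 0<ε = N , K≤N , small
  where
  K′ = suc K
  C = ι K′ ℚ.* t K′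
  A = proj₁ (archimedes C 0<ε)
  N = K′ ℕ.+ A
  K≤N : K ℕ.≤ N
  K≤N = ℕ.≤-trans (ℕ.n≤1+n K) (ℕ.m≤m+n K′ A)
  step : ∀ k → K′ ℕ.≤ k → ι (suc k) ℚ.* t (suc k) ℚ.≤ ι k ℚ.* t k
  step (suc k) K′≤ =
    ℚ.≤-trans (ℚ.≤-reflexive (cong (ℚ._* t″) (ι-suc (suc k))))
      (ℚ.≤-trans (monoʳ t″ (t≥0 _) (ℚ.+-monoˡ-≤ i (1≤ι-suc k)))
        (ℚ.≤-trans (ℚ.≤-reflexive eq)
          (monoˡ i (ι-nonNeg (suc k))
            (t-halving (suc k) (ℕ.≤-trans (ℕ.n≤1+n K) K′≤)))))
    where
    i = ι (suc k)
    t″ = t (suc (suc k))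
    eq : (i ℚ.+ i) ℚ.* t″ ≡ i ℚ.* (t″ ℚ.+ t″)
    eq = solve 2 (λ a b → (a :+ a) :* b := a :* (b :+ b)) refl i t″
  below : ∀ d → ι (d ℕ.+ K′) ℚ.* t (d ℕ.+ K′) ℚ.≤ C
  below zero    = ℚ.≤-refl
  below (suc d) = ℚ.≤-trans (step (d ℕ.+ K′) (ℕ.m≤n+m K′ d)) (below d)
  below′ : ∀ k → K′ ℕ.≤ k → ι k ℚ.* t k ℚ.≤ C
  below′ k K′≤k = subst (λ n → ι n ℚ.* t n ℚ.≤ C) (ℕ.m∸n+n≡m K′≤k) (below (k ℕ.∸ K′))
  small : ∀ k → N ℕ.≤ k → t k ℚ.< ε
  small k N≤k = ℚ.*-cancelˡ-<-nonNeg (ι k) {{ℚ.nonNegative (ι-nonNeg k)}}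
    (ℚ.≤-<-trans (below′ k (ℕ.≤-trans (ℕ.m≤m+n K′ A) N≤k))
      (ℚ.<-≤-trans (proj₂ (archimedes C 0<ε))
        (monoʳ ε (ℚ.<⇒≤ 0<ε) (ι-mono (ℕ.≤-trans (ℕ.m≤n+m A K′) N≤k)))))

tail-bound : ∀ {K} {t u : ℕ → ℚ} → (∀ k → dist (u (suc k)) (u k) ℚ.≤ t k) →
             Halving K t → ∀ m → K ℕ.≤ m → ∀ d →
             dist (u (d ℕ.+ m)) (u m) ℚ.≤
               (t m ℚ.+ t m) ℚ.- (t (d ℕ.+ m) ℚ.+ t (d ℕ.+ m))
tail-bound {t = t} {u} u-step t-halving m K≤m zero = ℚ.≤-reflexive
  (trans (cong ∣_∣ (ℚ.+-inverseʳ (u m))) (sym (ℚ.+-inverseʳ (t m ℚ.+ t m))))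
tail-bound {t = t} {u} u-step t-halving m K≤m (suc d) =
  ℚ.≤-trans (dist-triangle (u (suc n)) (u n) (u m))
    (ℚ.≤-trans (ℚ.+-mono-≤ (u-step n) (tail-bound {t = t} {u} u-step t-halving m K≤m d))
      (ℚ.≤-trans (ℚ.≤-reflexive eq)
        (ℚ.+-monoʳ-≤ (t m ℚ.+ t m)
          (ℚ.neg-antimono-≤ (t-halving n (ℕ.≤-trans K≤m (ℕ.m≤n+m m d)))))))
  where
  n = d ℕ.+ m
  eq : t n ℚ.+ ((t m ℚ.+ t m) ℚ.- (t n ℚ.+ t n)) ≡ (t m ℚ.+ t m) ℚ.- t n
  eq = solve 2 (λ a b → a :+ ((b :+ b) :- (a :+ a)) :=
                           (b :+ b) :- a) refl (t n) (t m)

-- The index N depends only on t, so the convergence is uniform in u.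
uniform-cauchy : ∀ K t → (∀ k → 0ℚ ℚ.≤ t k) → Halving K t →
  ∀ ε → 0ℚ ℚ.< ε → ∃ λ N → ∀ (u : ℕ → ℚ) → (∀ k → dist (u (suc k)) (u k) ℚ.≤ t k) →
  ∀ m n → N ℕ.≤ m → N ℕ.≤ n → dist (u m) (u n) ℚ.< ε
uniform-cauchy K t t≥0 t-halving ε 0<ε = N , close
  where
  δ = half (half ε)
  small = halving→0 K t t≥0 t-halving δ (half-pos (half-pos 0<ε))
  N = proj₁ small
  toN : ∀ (u : ℕ → ℚ) → (∀ k → dist (u (suc k)) (u k) ℚ.≤ t k) →
        ∀ m → N ℕ.≤ m → dist (u m) (u N) ℚ.< half ε
  toN u u-step m N≤m = ℚ.≤-<-trans
    (subst (λ n → dist (u n) (u N) ℚ.≤ t N ℚ.+ t N) (ℕ.m∸n+n≡m N≤m)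
      (ℚ.≤-trans (tail-bound {K} {t} {u} u-step t-halving N (proj₁ (proj₂ small)) d)
        (ℚ.≤-trans
          (ℚ.+-monoʳ-≤ (t N ℚ.+ t N) (ℚ.neg-antimono-≤ (nonNeg+ (t≥0 _) (t≥0 _))))
          (ℚ.≤-reflexive (ℚ.+-identityʳ (t N ℚ.+ t N))))))
    (<-halves tN tN)
    where
    d = m ℕ.∸ N
    tN = proj₂ (proj₂ small) N ℕ.≤-refl
  close : ∀ (u : ℕ → ℚ) → (∀ k → dist (u (suc k)) (u k) ℚ.≤ t k) →
          ∀ m n → N ℕ.≤ m → N ℕ.≤ n → dist (u m) (u n) ℚ.< ε
  close u u-step m n N≤m N≤n = via (u m) (u N) (u n) (toN u u-step m N≤m)
    (subst (ℚ._< half ε) (dist-sym (u n) (u N)) (toN u u-step n N≤n))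

pow : ℚ → ℕ → ℚ
pow p zero    = 1ℚ
pow p (suc n) = p ℚ.* pow p n

pow-nonNeg : ∀ {p} → 0ℚ ℚ.≤ p → ∀ n → 0ℚ ℚ.≤ pow p n
pow-nonNeg 0≤p zero    = 0≤1
pow-nonNeg 0≤p (suc n) = nonNeg* 0≤p (pow-nonNeg 0≤p n)

½^ : ℕ → ℚ
½^ = pow ½

½^-pos : ∀ n → 0ℚ ℚ.< ½^ n
½^-pos zero    = 0<1
½^-pos (suc n) = pos* 0<½ (½^-pos n)

½^-halving : Halving 0 ½^
½^-halving k _ = ℚ.≤-reflexive
  (trans (cong₂ ℚ._+_ (ℚ.*-comm ½ (½^ k)) (ℚ.*-comm ½ (½^ k))) (half+half (½^ k)))

IsCauchy : (ℕ → ℚ) → Set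
IsCauchy u = ∀ ε → 0ℚ ℚ.< ε →
  ∃ λ N → ∀ m n → N ℕ.≤ m → N ℕ.≤ n → ∣ u m ℚ.- u n ∣ ℚ.< ε

-- Equality of reals is _≈ᴿ_ below, not _≡_.
record ℝ : Set where
  constructor mkℝ
  field
    seq    : ℕ → ℚ
    cauchy : IsCauchy seq

open ℝ public

infix 4 _≈ᴿ[_]_ _≈ᴿ_ _≈_ _∈ℚ _⟶ᴿ_ _⟶_

-- This implies ∣ x - y ∣ ≤ ε, and is implied by ∣ x - y ∣ < ε, so that it may
-- replace either of them under a quantification over all ε > 0.
_≈ᴿ[_]_ : ℝ → ℚ → ℝ → Set
x ≈ᴿ[ ε ] y = ∃ λ N → ∀ n → N ℕ.≤ n → ∣ seq x n ℚ.- seq y n ∣ ℚ.< ε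

_≈ᴿ_ : ℝ → ℝ → Set
x ≈ᴿ y = ∀ ε → 0ℚ ℚ.< ε → x ≈ᴿ[ ε ] y

seq-bounded : ∀ x → ∃ λ B → 0ℚ ℚ.≤ B × (∀ n → ∣ seq x n ∣ ℚ.≤ B)
seq-bounded (mkℝ u c) = B , B≥0 , bound
  where
  S : ℕ → ℚ
  S zero    = ∣ u zero ∣
  S (suc n) = S n ℚ.+ ∣ u (suc n) ∣
  S≥0 : ∀ n → 0ℚ ℚ.≤ S n
  S≥0 zero    = ℚ.0≤∣p∣ (u zero)
  S≥0 (suc n) = nonNeg+ (S≥0 n) (ℚ.0≤∣p∣ (u (suc n)))
  self : ∀ n → ∣ u n ∣ ℚ.≤ S n
  self zero    = ℚ.≤-refl
  self (suc n) = ≤+ˡ (S≥0 n)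
  S-mono : ∀ n d → S n ℚ.≤ S (d ℕ.+ n)
  S-mono n zero    = ℚ.≤-refl
  S-mono n (suc d) = ℚ.≤-trans (S-mono n d) (≤+ʳ (ℚ.0≤∣p∣ (u (suc (d ℕ.+ n)))))
  N = proj₁ (c 1ℚ 0<1)
  B = S N ℚ.+ 1ℚ
  B≥0 : 0ℚ ℚ.≤ B
  B≥0 = nonNeg+ (S≥0 N) 0≤1
  bound : ∀ n → ∣ u n ∣ ℚ.≤ B
  bound n with ℕ.≤-total n N
  ... | inj₁ n≤N = ℚ.≤-trans (self n) (ℚ.≤-trans
        (subst (λ k → S n ℚ.≤ S k) (ℕ.m∸n+n≡m n≤N) (S-mono n (N ℕ.∸ n))) (≤+ʳ 0≤1))
  ... | inj₂ N≤n = subst (λ p → ∣ p ∣ ℚ.≤ B) eq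
        (ℚ.≤-trans (ℚ.∣p+q∣≤∣p∣+∣q∣ (u N) (u n ℚ.- u N))
          (ℚ.+-mono-≤ (self N) (ℚ.<⇒≤ (proj₂ (c 1ℚ 0<1) n N N≤n ℕ.≤-refl))))
    where
    eq : u N ℚ.+ (u n ℚ.- u N) ≡ u n
    eq = solve 2 (λ a b → a :+ (b :- a) := b) refl (u N) (u n)

ℚ→ℝ : ℚ → ℝ
ℚ→ℝ p = mkℝ (λ _ → p) λ ε 0<ε → 0 , λ _ _ _ _ →
  subst (ℚ._< ε) (cong ∣_∣ (sym (ℚ.+-inverseʳ p))) 0<ε

infixl 6 _+ᴿ_ _-ᴿ_ _+_
infixl 7 _*ᴿ_ _*_
infix  8 -ᴿ_
infixr 8 _^_

_+ᴿ_ : ℝ → ℝ → ℝ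
mkℝ u cu +ᴿ mkℝ v cv = mkℝ (λ n → u n ℚ.+ v n) λ ε 0<ε →
  let
    (M , cM) = cu (half ε) (half-pos 0<ε)
    (N , cN) = cv (half ε) (half-pos 0<ε)
  in M ℕ.+ N , λ m n N≤m N≤n → ℚ.≤-<-trans
    (subst (λ p → ∣ p ∣ ℚ.≤ dist (u m) (u n) ℚ.+ dist (v m) (v n))
      (solve 4 (λ a b c d → (a :- b) :+ (c :- d) :=
                               (a :+ c) :- (b :+ d))
        refl (u m) (u n) (v m) (v n))
      (ℚ.∣p+q∣≤∣p∣+∣q∣ (u m ℚ.- u n) (v m ℚ.- v n)))
    (<-halves
      (cM m n (ℕ.≤-trans (ℕ.m≤m+n M N) N≤m) (ℕ.≤-trans (ℕ.m≤m+n M N) N≤n))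
      (cN m n (ℕ.≤-trans (ℕ.m≤n+m N M) N≤m) (ℕ.≤-trans (ℕ.m≤n+m N M) N≤n)))

-ᴿ_ : ℝ → ℝ
-ᴿ mkℝ u cu = mkℝ (λ n → ℚ.- u n) λ ε 0<ε →
  let (N , cN) = cu ε 0<ε in
  N , λ m n N≤m N≤n → subst (ℚ._< ε)
    (trans (sym (ℚ.∣-p∣≡∣p∣ (u m ℚ.- u n))) (cong ∣_∣ (ℚ.neg-distrib-+ (u m) (ℚ.- u n))))
    (cN m n N≤m N≤n)

_-ᴿ_ : ℝ → ℝ → ℝ
x -ᴿ y = x +ᴿ (-ᴿ y)

_*ᴿ_ : ℝ → ℝ → ℝ
x@(mkℝ u cu) *ᴿ y@(mkℝ v cv) = mkℝ (λ n → u n ℚ.* v n) uv-cauchy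
  where
  B = proj₁ (seq-bounded x) ℚ.+ proj₁ (seq-bounded y) ℚ.+ 1ℚ
  Bx≥0 = proj₁ (proj₂ (seq-bounded x))
  By≥0 = proj₁ (proj₂ (seq-bounded y))
  B>0 : 0ℚ ℚ.< B
  B>0 = ℚ.<-≤-trans 0<1 (≤+ˡ (nonNeg+ Bx≥0 By≥0))
  u≤B : ∀ n → ∣ u n ∣ ℚ.≤ B
  u≤B n = ℚ.≤-trans (proj₂ (proj₂ (seq-bounded x)) n) (ℚ.≤-trans (≤+ʳ By≥0) (≤+ʳ 0≤1))
  v≤B : ∀ n → ∣ v n ∣ ℚ.≤ B
  v≤B n = ℚ.≤-trans (proj₂ (proj₂ (seq-bounded y)) n) (ℚ.≤-trans (≤+ˡ Bx≥0) (≤+ʳ 0≤1))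
  instance
    B-positive = ℚ.positive B>0
    B-nonZero = ℚ.pos⇒nonZero B
  uv-cauchy : IsCauchy (λ n → u n ℚ.* v n)
  uv-cauchy ε 0<ε = M ℕ.+ N , close
    where
    δ = half ε ℚ.* ℚ.1/ B
    0<δ : 0ℚ ℚ.< δ
    0<δ = pos* (half-pos 0<ε) (ℚ.positive⁻¹ (ℚ.1/ B) {{ℚ.1/pos⇒pos B}})
    M = proj₁ (cu δ 0<δ)
    N = proj₁ (cv δ 0<δ)
    scale : ∀ {a b} → ∣ a ∣ ℚ.< δ → ∣ b ∣ ℚ.≤ B → ∣ a ℚ.* b ∣ ℚ.< half ε
    scale {a} {b} a<δ b≤B = ℚ.≤-<-trans
      (ℚ.≤-trans (ℚ.≤-reflexive (ℚ.∣p*q∣≡∣p∣*∣q∣ a b)) (monoˡ ∣ a ∣ (ℚ.0≤∣p∣ a) b≤B))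
      (subst (∣ a ∣ ℚ.* B ℚ.<_)
        (trans (ℚ.*-assoc (half ε) (ℚ.1/ B) B)
          (trans (cong (half ε ℚ.*_) (ℚ.*-inverseˡ B)) (ℚ.*-identityʳ (half ε))))
        (ℚ.*-monoˡ-<-pos B a<δ))
    close : ∀ m n → M ℕ.+ N ℕ.≤ m → M ℕ.+ N ℕ.≤ n →
            ∣ u m ℚ.* v m ℚ.- u n ℚ.* v n ∣ ℚ.< ε
    close m n ≤m ≤n = subst (λ p → ∣ p ∣ ℚ.< ε)
      (solve 4 (λ a b c d → (a :- b) :* c :+ (c :- d) :* b :=
                               a :* c :- b :* d)
        refl (u m) (u n) (v m) (v n))
      (ℚ.≤-<-trans
        (ℚ.∣p+q∣≤∣p∣+∣q∣ ((u m ℚ.- u n) ℚ.* v m) ((v m ℚ.- v n) ℚ.* u n))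
        (<-halves
          (scale (proj₂ (cu δ 0<δ) m n (ℕ.≤-trans (ℕ.m≤m+n M N) ≤m)
                                       (ℕ.≤-trans (ℕ.m≤m+n M N) ≤n)) (v≤B m))
          (scale (proj₂ (cv δ 0<δ) m n (ℕ.≤-trans (ℕ.m≤n+m N M) ≤m)
                                       (ℕ.≤-trans (ℕ.m≤n+m N M) ≤n)) (u≤B n))))

IsCauchyᴿ : (ℕ → ℝ) → Set
IsCauchyᴿ X = ∀ ε → 0ℚ ℚ.< ε →
  ∃ λ N → ∀ m n → N ℕ.≤ m → N ℕ.≤ n → X m ≈ᴿ[ ε ] X n

_⟶ᴿ_ : (ℕ → ℝ) → ℝ → Set
X ⟶ᴿ x = ∀ ε → 0ℚ ℚ.< ε → ∃ λ N → ∀ n → N ℕ.≤ n → X n ≈ᴿ[ ε ] x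

-- The n-th entry of the limit is a rational within 2⁻ⁿ of X n.
module _ (X : ℕ → ℝ) (X-cauchy : IsCauchyᴿ X) where

  private

    index : ℕ → ℕ
    index n = proj₁ (cauchy (X n) (½^ n) (½^-pos n))

    y : ℕ → ℚ
    y n = seq (X n) (index n)

    near : ∀ n j → index n ℕ.≤ j → dist (y n) (seq (X n) j) ℚ.< ½^ n
    near n j = proj₂ (cauchy (X n) (½^ n) (½^-pos n)) (index n) j ℕ.≤-refl

    ½^-small : ∀ ε → 0ℚ ℚ.< ε → ∃ λ N → ∀ k → N ℕ.≤ k → ½^ k ℚ.< ε
    ½^-small ε 0<ε =
      let (N , _ , small) = halving→0 0 ½^ (λ k → ℚ.<⇒≤ (½^-pos k)) ½^-halving ε 0<ε
      in N , small

    y-cauchy : IsCauchy y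
    y-cauchy ε 0<ε = M ℕ.+ N , close
      where
      0<ε/2 = half-pos 0<ε
      0<ε/4 = half-pos 0<ε/2
      M = proj₁ (½^-small (half (half ε)) 0<ε/4)
      N = proj₁ (X-cauchy (half (half ε)) 0<ε/4)
      quarter<half : half (half ε) ℚ.< half ε
      quarter<half = subst₂ ℚ._<_ (ℚ.+-identityˡ _) (half+half (half ε))
        (ℚ.+-monoˡ-< (half (half ε)) 0<ε/4)
      close : ∀ m n → M ℕ.+ N ℕ.≤ m → M ℕ.+ N ℕ.≤ n → dist (y m) (y n) ℚ.< ε
      close m n ≤m ≤n = via (y m) (seq (X m) j) (y n)
          (ℚ.<-trans (ℚ.<-trans (near m j m≤j) ½^m) quarter<half)
          (via (seq (X m) j) (seq (X n) j) (y n) (Xmn j k≤j)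
            (subst (ℚ._< half (half ε)) (dist-sym (y n) (seq (X n) j))
              (ℚ.<-trans (near n j n≤j) ½^n)))
        where
        XX = proj₂ (X-cauchy (half (half ε)) 0<ε/4) m n
               (ℕ.≤-trans (ℕ.m≤n+m N M) ≤m) (ℕ.≤-trans (ℕ.m≤n+m N M) ≤n)
        Xmn = proj₂ XX
        k = proj₁ XX
        j = k ℕ.+ (index m ℕ.+ index n)
        k≤j = ℕ.m≤m+n k (index m ℕ.+ index n)
        m≤j = ℕ.≤-trans (ℕ.m≤m+n (index m) (index n)) (ℕ.m≤n+m _ k)
        n≤j = ℕ.≤-trans (ℕ.m≤n+m (index n) (index m)) (ℕ.m≤n+m _ k)
        ½^m = proj₂ (½^-small (half (half ε)) 0<ε/4) m (ℕ.≤-trans (ℕ.m≤m+n M N) ≤m)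
        ½^n = proj₂ (½^-small (half (half ε)) 0<ε/4) n (ℕ.≤-trans (ℕ.m≤m+n M N) ≤n)

  limᴿ : ℝ
  limᴿ = mkℝ y y-cauchy

  limᴿ-converges : X ⟶ᴿ limᴿ
  limᴿ-converges ε 0<ε = M ℕ.+ N , close
    where
    0<ε/2 = half-pos 0<ε
    M = proj₁ (½^-small (half ε) 0<ε/2)
    N = proj₁ (y-cauchy (half ε) 0<ε/2)
    close : ∀ n → M ℕ.+ N ℕ.≤ n → X n ≈ᴿ[ ε ] limᴿ
    close n ≤n = index n ℕ.+ N , λ j ≤j → via (seq (X n) j) (y n) (y j)
      (subst (ℚ._< half ε) (dist-sym (y n) (seq (X n) j))
        (ℚ.<-trans (near n j (ℕ.≤-trans (ℕ.m≤m+n (index n) N) ≤j))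
          (proj₂ (½^-small (half ε) 0<ε/2) n (ℕ.≤-trans (ℕ.m≤m+n M N) ≤n))))
      (proj₂ (y-cauchy (half ε) 0<ε/2) n j
        (ℕ.≤-trans (ℕ.m≤n+m N M) ≤n) (ℕ.≤-trans (ℕ.m≤n+m N (index n)) ≤j))

record ℂ : Set where
  constructor _+i_
  field
    re im : ℝ

open ℂ public

_≈_ : ℂ → ℂ → Set
z ≈ w = re z ≈ᴿ re w × im z ≈ᴿ im w

ℚ→ℂ : ℚ → ℂ
ℚ→ℂ p = ℚ→ℝ p +i ℚ→ℝ 0ℚ

_+_ : ℂ → ℂ → ℂ
(a +i b) + (c +i d) = (a +ᴿ c) +i (b +ᴿ d)

_*_ : ℂ → ℂ → ℂ
(a +i b) * (c +i d) = (a *ᴿ c -ᴿ b *ᴿ d) +i (a *ᴿ d +ᴿ b *ᴿ c)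

_^_ : ℂ → ℕ → ℂ
z ^ zero  = ℚ→ℂ 1ℚ
z ^ suc n = z * z ^ n

_∈ℚ : ℂ → Set
z ∈ℚ = ∃ λ p → z ≈ ℚ→ℂ p

Irrational : ℂ → Set
Irrational z = ¬ (z ∈ℚ)

IsCauchyᶜ : (ℕ → ℂ) → Set
IsCauchyᶜ Z = IsCauchyᴿ (λ n → re (Z n)) × IsCauchyᴿ (λ n → im (Z n))

_⟶_ : (ℕ → ℂ) → ℂ → Set
Z ⟶ z = ((λ n → re (Z n)) ⟶ᴿ re z) × ((λ n → im (Z n)) ⟶ᴿ im z)

lim : (Z : ℕ → ℂ) → IsCauchyᶜ Z → ℂ
lim Z (re-cauchy , im-cauchy) =
  limᴿ (λ n → re (Z n)) re-cauchy +i limᴿ (λ n → im (Z n)) im-cauchy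

lim-converges : ∀ Z Z-cauchy → Z ⟶ lim Z Z-cauchy
lim-converges Z (re-cauchy , im-cauchy) =
  limᴿ-converges (λ n → re (Z n)) re-cauchy , limᴿ-converges (λ n → im (Z n)) im-cauchy

-- cos z = Σₖ (-1)ᵏ z²ᵏ / (2k)!
cosCoeff : ℕ → ℚ
cosCoeff k = ((-1ℤ ℤ.^ k) ℚ./ ((2 ℕ.* k) !)) {{(2 ℕ.* k) ℕ.!≢0}}

cosTerm : ℂ → ℕ → ℂ
cosTerm z k = ℚ→ℂ (cosCoeff k) * z ^ (2 ℕ.* k)

cosPartial : ℂ → ℕ → ℂ
cosPartial z zero    = ℚ→ℂ 0ℚ
cosPartial z (suc n) = cosPartial z n + cosTerm z n

-- The ℓ¹ norm of the j-th rational approximation to z.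
norm : ℂ → ℕ → ℚ
norm z j = ∣ seq (re z) j ∣ ℚ.+ ∣ seq (im z) j ∣

norm-nonNeg : ∀ z j → 0ℚ ℚ.≤ norm z j
norm-nonNeg z j = nonNeg+ (ℚ.0≤∣p∣ (seq (re z) j)) (ℚ.0≤∣p∣ (seq (im z) j))

norm-* : ∀ z w j → norm (z * w) j ℚ.≤ norm z j ℚ.* norm w j
norm-* z w j = ℚ.≤-trans
  (ℚ.+-mono-≤
    (ℚ.≤-trans (ℚ.∣p-q∣≤∣p∣+∣q∣ (a ℚ.* c) (b ℚ.* d))
      (ℚ.≤-reflexive (cong₂ ℚ._+_ (ℚ.∣p*q∣≡∣p∣*∣q∣ a c) (ℚ.∣p*q∣≡∣p∣*∣q∣ b d))))
    (ℚ.≤-trans (ℚ.∣p+q∣≤∣p∣+∣q∣ (a ℚ.* d) (b ℚ.* c))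
      (ℚ.≤-reflexive (cong₂ ℚ._+_ (ℚ.∣p*q∣≡∣p∣*∣q∣ a d) (ℚ.∣p*q∣≡∣p∣*∣q∣ b c)))))
  (ℚ.≤-reflexive
    (solve 4 (λ p q r s →
        (p :* r :+ q :* s) :+ (p :* s :+ q :* r) :=
        (p :+ q) :* (r :+ s))
      refl (∣ a ∣) (∣ b ∣) (∣ c ∣) (∣ d ∣)))
  where
  a = seq (re z) j
  b = seq (im z) j
  c = seq (re w) j
  d = seq (im w) j

inv! : ℕ → ℚ
inv! n = (+ 1 ℚ./ n !) {{n ℕ.!≢0}}

1/ℕ : ∀ n .{{_ : ℕ.NonZero n}} → ℚ
1/ℕ n = + 1 ℚ./ n

*-1/ℕ : ∀ a b .{{_ : ℕ.NonZero b}} .{{_ : ℕ.NonZero (suc a ℕ.* b)}} →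
        ι (suc a) ℚ.* 1/ℕ (suc a ℕ.* b) ≡ 1/ℕ b
*-1/ℕ a (suc b-1) = trans
  (fromℚᵘ-homo-* p q)
  (ℚ.fromℚᵘ-cong {p ℚᵘ.* q} {mkℚᵘ (+ 1) b-1} (*≡* (cong +_ eq)))
  where
  p = mkℚᵘ (+ suc a) 0
  q = mkℚᵘ (+ 1) (b-1 ℕ.+ a ℕ.* suc b-1)
  eq : suc a ℕ.* 1 ℕ.* suc b-1 ≡ 1 ℕ.* (1 ℕ.* (suc a ℕ.* suc b-1))
  eq = trans (cong (ℕ._* suc b-1) (ℕ.*-identityʳ (suc a)))
         (sym (trans (ℕ.*-identityˡ (1 ℕ.* (suc a ℕ.* suc b-1)))
                     (ℕ.*-identityˡ (suc a ℕ.* suc b-1))))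

inv!-suc : ∀ n → ι (suc n) ℚ.* inv! (suc n) ≡ inv! n
inv!-suc n = *-1/ℕ n (n !) {{n ℕ.!≢0}} {{suc n ℕ.!≢0}}

inv!-nonNeg : ∀ n → 0ℚ ℚ.≤ inv! n
inv!-nonNeg n = ℚ.nonNegative⁻¹ _ {{ℚ.normalize-nonNeg 1 (n !) {{n ℕ.!≢0}}}}

-1^ : ∀ k → -1ℤ ℤ.^ k ≡ + 1 ⊎ -1ℤ ℤ.^ k ≡ -1ℤ
-1^ zero    = inj₁ refl
-1^ (suc k) with -1^ k
... | inj₁ eq = inj₂ (cong (-1ℤ ℤ.*_) eq)
... | inj₂ eq = inj₁ (cong (-1ℤ ℤ.*_) eq)

∣cosCoeff∣ : ∀ k → ∣ cosCoeff k ∣ ≡ inv! (2 ℕ.* k)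
∣cosCoeff∣ k with -1ℤ ℤ.^ k | -1^ k
... | _ | inj₁ refl = ℚ.0≤p⇒∣p∣≡p (inv!-nonNeg (2 ℕ.* k))
... | _ | inj₂ refl = trans (ℚ.∣-p∣≡∣p∣ (inv! (2 ℕ.* k)))
                            (ℚ.0≤p⇒∣p∣≡p (inv!-nonNeg (2 ℕ.* k)))

norm-cosCoeff : ∀ k j → norm (ℚ→ℂ (cosCoeff k)) j ≡ inv! (2 ℕ.* k)
norm-cosCoeff k j = trans (ℚ.+-identityʳ ∣ cosCoeff k ∣) (∣cosCoeff∣ k)

module Majorant (z : ℂ) where

  M : ℚ
  M = proj₁ (seq-bounded (re z)) ℚ.+ proj₁ (seq-bounded (im z))

  M≥0 : 0ℚ ℚ.≤ M
  M≥0 = nonNeg+ (proj₁ (proj₂ (seq-bounded (re z)))) (proj₁ (proj₂ (seq-bounded (im z))))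

  norm≤M : ∀ j → norm z j ℚ.≤ M
  norm≤M j = ℚ.+-mono-≤ (proj₂ (proj₂ (seq-bounded (re z))) j)
                        (proj₂ (proj₂ (seq-bounded (im z))) j)

  norm-^ : ∀ n j → norm (z ^ n) j ℚ.≤ pow M n
  norm-^ zero    j = ℚ.≤-refl
  norm-^ (suc n) j = ℚ.≤-trans (norm-* z (z ^ n) j)
    (mono* (norm-nonNeg (z ^ n) j) M≥0 (norm≤M j) (norm-^ n j))

  t : ℕ → ℚ
  t k = inv! (2 ℕ.* k) ℚ.* pow M (2 ℕ.* k)

  t≥0 : ∀ k → 0ℚ ℚ.≤ t k
  t≥0 k = nonNeg* (inv!-nonNeg (2 ℕ.* k)) (pow-nonNeg M≥0 (2 ℕ.* k))

  norm-cosTerm : ∀ k j → norm (cosTerm z k) j ℚ.≤ t k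
  norm-cosTerm k j = ℚ.≤-trans (norm-* (ℚ→ℂ (cosCoeff k)) (z ^ (2 ℕ.* k)) j)
    (mono* (norm-nonNeg (z ^ (2 ℕ.* k)) j) (inv!-nonNeg (2 ℕ.* k))
      (ℚ.≤-reflexive (norm-cosCoeff k j)) (norm-^ (2 ℕ.* k) j))

  K : ℕ
  K = proj₁ (ceil (M ℚ.* M ℚ.+ M ℚ.* M))

  t-halving : Halving K t
  t-halving k K≤k = subst (λ n → s n ℚ.+ s n ℚ.≤ s (2 ℕ.* k)) (sym (ℕ.*-suc 2 k))
    (ℚ.≤-trans (ℚ.≤-reflexive eq₁)
      (ℚ.≤-trans (monoˡ (e ℚ.* P) (nonNeg* (inv!-nonNeg (2 ℕ.+ n)) (pow-nonNeg M≥0 n)) 2MM≤)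
        (ℚ.≤-reflexive eq₂)))
    where
    s : ℕ → ℚ
    s m = inv! m ℚ.* pow M m
    n = 2 ℕ.* k
    e = inv! (2 ℕ.+ n)
    P = pow M n
    eq₁ : e ℚ.* (M ℚ.* (M ℚ.* P)) ℚ.+ e ℚ.* (M ℚ.* (M ℚ.* P)) ≡
          (e ℚ.* P) ℚ.* (M ℚ.* M ℚ.+ M ℚ.* M)
    eq₁ = solve 3 (λ e M P →
        e :* (M :* (M :* P)) :+ e :* (M :* (M :* P)) :=
        (e :* P) :* (M :* M :+ M :* M)) refl e M P
    2MM≤ : M ℚ.* M ℚ.+ M ℚ.* M ℚ.≤ ι (1 ℕ.+ n) ℚ.* ι (2 ℕ.+ n)
    2MM≤ = ℚ.≤-trans (proj₂ (ceil (M ℚ.* M ℚ.+ M ℚ.* M)))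
      (ℚ.≤-trans (ι-mono (ℕ.≤-trans K≤k (ℕ.≤-trans (ℕ.m≤m+n k (k ℕ.+ 0)) (ℕ.m≤n+m n 2))))
        (subst (ℚ._≤ ι (1 ℕ.+ n) ℚ.* ι (2 ℕ.+ n)) (ℚ.*-identityˡ (ι (2 ℕ.+ n)))
          (monoʳ (ι (2 ℕ.+ n)) (ι-nonNeg (2 ℕ.+ n)) (1≤ι-suc n))))
    eq₂ : (e ℚ.* P) ℚ.* (ι (1 ℕ.+ n) ℚ.* ι (2 ℕ.+ n)) ≡ s n
    eq₂ = trans
      (solve 4 (λ e P a b → (e :* P) :* (a :* b) :=
                               (a :* (b :* e)) :* P)
        refl e P (ι (1 ℕ.+ n)) (ι (2 ℕ.+ n)))
      (cong (ℚ._* P)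
        (trans (cong (ι (1 ℕ.+ n) ℚ.*_) (inv!-suc (1 ℕ.+ n))) (inv!-suc n)))

  increment : ∀ p q → dist (p ℚ.+ q) p ≡ ∣ q ∣
  increment p q = cong ∣_∣
    (solve 2 (λ a b → (a :+ b) :- a := b) refl p q)

  re-step : ∀ j k → dist (seq (re (cosPartial z (suc k))) j)
                         (seq (re (cosPartial z k)) j) ℚ.≤ t k
  re-step j k = ℚ.≤-trans
    (ℚ.≤-reflexive (increment (seq (re (cosPartial z k)) j) (seq (re (cosTerm z k)) j)))
    (ℚ.≤-trans (≤+ʳ (ℚ.0≤∣p∣ (seq (im (cosTerm z k)) j))) (norm-cosTerm k j))

  im-step : ∀ j k → dist (seq (im (cosPartial z (suc k))) j)
                         (seq (im (cosPartial z k)) j) ℚ.≤ t k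
  im-step j k = ℚ.≤-trans
    (ℚ.≤-reflexive (increment (seq (im (cosPartial z k)) j) (seq (im (cosTerm z k)) j)))
    (ℚ.≤-trans (≤+ˡ (ℚ.0≤∣p∣ (seq (re (cosTerm z k)) j))) (norm-cosTerm k j))

cosPartial-cauchy : ∀ z → IsCauchyᶜ (cosPartial z)
cosPartial-cauchy z = part re re-step , part im im-step
  where
  open Majorant z
  part : (f : ℂ → ℝ) →
         (∀ j k → dist (seq (f (cosPartial z (suc k))) j) (seq (f (cosPartial z k)) j) ℚ.≤ t k) →
         IsCauchyᴿ (λ n → f (cosPartial z n))
  part f f-step ε 0<ε =
    let (N , close) = uniform-cauchy K t t≥0 t-halving ε 0<ε
    in N , λ m n N≤m N≤n → 0 , λ j _ →
         close (λ k → seq (f (cosPartial z k)) j) (f-step j) m n N≤m N≤n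

cos : ℂ → ℂ
cos z = lim (cosPartial z) (cosPartial-cauchy z)

cos-converges : ∀ z → cosPartial z ⟶ cos z
cos-converges z = lim-converges (cosPartial z) (cosPartial-cauchy z)

{-# OPTIONS --safe #-}
module Submission where

-- Write -r² = a/b and suppose cos r = p = e/d.  The moments
--   R m = d (-b)ᵐ ∫₀ʳ y²ᵐ sin (r - y) dy = d bᵐ (2m)! (Σ_{k≤m} (-r²)ᵏ/(2k)! - p)
-- are integers growing at most geometrically, and so do their n-th differences
--   Δ n R m = ± d bᵐ⁺ⁿ ∫₀ʳ y²ᵐ (r² - y²)ⁿ sin (r - y) dy,
-- which are divisible by n! for n ≤ m.  Hence Δ n R m = 0 for large n ≤ m ≤ 2n + 3.
-- The integration-by-parts recurrence expresses Δ n R (m + 2) through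
-- Δ (n + 1) R (m + 1), Δ (n + 2) R (m + 1) and Δ (n + 2) R m, so the vanishing descends
-- to n = 0: two consecutive moments are 0, contradicting R (m + 1) = C (m + 1) R m + d aᵐ⁺¹.
-- No integrals are needed, as R is defined by the last recurrence.

open import Defs
open import Data.Integer.Base as ℤ using (ℤ; +_; 0ℤ; 1ℤ)
import Data.Integer.Properties as ℤ
open import Data.Integer.Divisibility.Signed
  using (_∣_; divides; ∣⇒∣ᵤ; ∣-refl; ∣-trans; ∣m∣n⇒∣m+n; ∣m∣n⇒∣m-n; ∣n⇒∣m*n; ∣ᵤ⇒∣)
import Data.Integer.Solver as ℤ-Solver
open import Data.Nat.Base as ℕ using (ℕ; zero; suc; _!)
import Data.Nat.Divisibility as ℕ
import Data.Nat.Properties as ℕ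
import Data.Nat.Solver as ℕ-Solver
open import Data.Product.Base using (∃; _,_; proj₁; proj₂)
open import Data.Sum.Base using (inj₁; inj₂; [_,_]′)
open import Data.Rational.Base as ℚ using (ℚ; 0ℚ; 1ℚ; ∣_∣; ↥_; ↧_; ↧ₙ_; toℚᵘ)
import Data.Rational.Properties as ℚ
import Data.Rational.Solver as ℚ-Solver
open import Data.Rational.Unnormalised.Base as ℚᵘ using (mkℚᵘ; *≡*)
open import Function.Base using (id; _∘_)
open import Relation.Nullary.Negation using (¬_; contradiction)
open import Relation.Binary.PropositionalEquality
  using (_≡_; _≢_; refl; sym; trans; cong; cong₂; subst; subst₂; module ≡-Reasoning)

private
  module ℤS = ℤ-Solver.+-*-Solver
  module ℚS = ℚ-Solver.+-*-Solver
  module ℕS = ℕ-Solver.+-*-Solver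

-- Two-step descent, and factorials against geometric growth.

-- Each step consumes the two preceding values, matching a second-order recurrence. The bound
-- `n < k` is passed on because the descent of the vanishing uses it to exclude indices that are too
-- small.
downward : ∀ (P : ℕ → Set) k → (∀ n → n ℕ.< k → P (2 ℕ.+ n) → P (1 ℕ.+ n) → P n) →
           P k → P (suc k) → P 0
downward P zero    step p p′ = p
downward P (suc k) step p p′ =
  downward P k (λ n n<k → step n (ℕ.m<n⇒m<1+n n<k)) (step k ℕ.≤-refl p′ p) p

n<2^n : ∀ n → n ℕ.< 2 ℕ.^ n
n<2^n zero    = ℕ.≤-refl
n<2^n (suc n) = ℕ.≤-trans (ℕ.+-mono-≤ (ℕ.m^n>0 2 n) (n<2^n n))
  (ℕ.≤-reflexive (cong (2 ℕ.^ n ℕ.+_) (sym (ℕ.+-identityʳ (2 ℕ.^ n)))))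

^-distribˡ-* : ∀ k x y → (x ℕ.* y) ℕ.^ k ≡ x ℕ.^ k ℕ.* y ℕ.^ k
^-distribˡ-* zero    x y = refl
^-distribˡ-* (suc k) x y = trans (cong (x ℕ.* y ℕ.*_) (^-distribˡ-* k x y))
  (ℕ.[m*n]*[o*p]≡[m*o]*[n*p] x y (x ℕ.^ k) (y ℕ.^ k))

-- Each of the last `k` factors of `(c + k)!` is at least `c`.
^≤! : ∀ c k → c ℕ.^ k ℕ.≤ (c ℕ.+ k) !
^≤! c zero    = ℕ.n≢0⇒n>0 (λ eq → ℕ.≢-nonZero⁻¹ _ {{(c ℕ.+ 0) ℕ.!≢0}} eq)
^≤! c (suc k) = subst (λ n → c ℕ.* c ℕ.^ k ℕ.≤ n !) (sym (ℕ.+-suc c k))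
  (ℕ.*-mono-≤ (ℕ.≤-trans (ℕ.m≤m+n c k) (ℕ.n≤1+n _)) (^≤! c k))

-- Write `n = 2x + k` with `k ≥ v = w x^(2x)`. Then `w x^n = v x^k`, and `v < 2^v ≤ 2^k` bounds this
-- by `(2x)^k`, which is at most `(2x + k)!`.
^-<-! : ∀ w x .{{_ : ℕ.NonZero x}} →
        ∃ λ n₀ → ∀ n → n₀ ℕ.≤ n → w ℕ.* x ℕ.^ n ℕ.< n !
^-<-! w x = 2 ℕ.* x ℕ.+ v , λ n n₀≤n →
  subst (λ n → w ℕ.* x ℕ.^ n ℕ.< n !) (ℕ.m+[n∸m]≡n n₀≤n) (bound (n ℕ.∸ (2 ℕ.* x ℕ.+ v)))
  where
  v = w ℕ.* x ℕ.^ (2 ℕ.* x)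
  bound : ∀ d → w ℕ.* x ℕ.^ (2 ℕ.* x ℕ.+ v ℕ.+ d) ℕ.< (2 ℕ.* x ℕ.+ v ℕ.+ d) !
  bound d = begin-strict
    w ℕ.* x ℕ.^ (2 ℕ.* x ℕ.+ v ℕ.+ d)
      ≡⟨ cong (λ n → w ℕ.* x ℕ.^ n) (ℕ.+-assoc (2 ℕ.* x) v d) ⟩
    w ℕ.* x ℕ.^ (2 ℕ.* x ℕ.+ k)
      ≡⟨ cong (w ℕ.*_) (ℕ.^-distribˡ-+-* x (2 ℕ.* x) k) ⟩
    w ℕ.* (x ℕ.^ (2 ℕ.* x) ℕ.* x ℕ.^ k)
      ≡⟨ sym (ℕ.*-assoc w _ _) ⟩
    v ℕ.* x ℕ.^ k
      <⟨ ℕ.*-monoˡ-< (x ℕ.^ k) {{ℕ.m^n≢0 x k}} (n<2^n v) ⟩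
    2 ℕ.^ v ℕ.* x ℕ.^ k
      ≤⟨ ℕ.*-monoˡ-≤ (x ℕ.^ k) (ℕ.^-monoʳ-≤ 2 (ℕ.m≤m+n v d)) ⟩
    2 ℕ.^ k ℕ.* x ℕ.^ k
      ≡⟨ sym (^-distribˡ-* k 2 x) ⟩
    (2 ℕ.* x) ℕ.^ k
      ≤⟨ ^≤! (2 ℕ.* x) k ⟩
    (2 ℕ.* x ℕ.+ k) !
      ≡⟨ cong _! (sym (ℕ.+-assoc (2 ℕ.* x) v d)) ⟩
    (2 ℕ.* x ℕ.+ v ℕ.+ d) ! ∎
    where
    open ℕ.≤-Reasoning
    k = v ℕ.+ d

-- Twisted finite differences and their recurrence.

module Differences (a : ℤ) where

  -- This is `(a - T)^n` for the shift `T`. On moments with weight `(-b y²)^m`, where `a = -b r²`,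
  -- each application inserts a factor `-b (r² - y²)` under the integral.
  Δ : ℕ → (ℕ → ℤ) → ℕ → ℤ
  Δ zero    R m = R m
  Δ (suc n) R m = a ℤ.* Δ n R m ℤ.- Δ n R (suc m)

  Δ-linear : ∀ x y R S n m →
    Δ n (λ k → x ℤ.* R k ℤ.- y ℤ.* S k) m ≡ x ℤ.* Δ n R m ℤ.- y ℤ.* Δ n S m
  Δ-linear x y R S zero    m = refl
  Δ-linear x y R S (suc n) m = trans
    (cong₂ (λ u v → a ℤ.* u ℤ.- v) (Δ-linear x y R S n m) (Δ-linear x y R S n (suc m)))
    (ℤS.solve 7 (λ a x y p q r s →
        a :* (x :* p :- y :* q) :- (x :* r :- y :* s) :=
        x :* (a :* p :- r) :- y :* (a :* q :- s))
      refl a x y (Δ n R m) (Δ n S m) (Δ n R (suc m)) (Δ n S (suc m)))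
    where open ℤS

  Δ-cong : ∀ {R S} k → (∀ m → R m ≡ S (k ℕ.+ m)) → ∀ n m → Δ n R m ≡ Δ n S (k ℕ.+ m)
  Δ-cong k eq zero    m = eq m
  Δ-cong {S = S} k eq (suc n) m = cong₂ (λ u v → a ℤ.* u ℤ.- v) (Δ-cong k eq n m)
    (trans (Δ-cong k eq n (suc m)) (cong (Δ n S) (ℕ.+-suc k m)))

  -- `Δ n R m` combines only `R m`, ..., `R (m + n)`, and `D m` divides all of these along the
  -- chain.
  Δ-∣ : ∀ {R} (D : ℕ → ℤ) → (∀ m → D m ∣ D (suc m)) → (∀ m → D m ∣ R m) →
        ∀ n m → D m ∣ Δ n R m
  Δ-∣ D D∣D D∣R zero    m = D∣R m
  Δ-∣ D D∣D D∣R (suc n) m = ∣m∣n⇒∣m-n (∣n⇒∣m*n a (Δ-∣ D D∣D D∣R n m))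
    (∣-trans (D∣D m) (Δ-∣ D D∣D D∣R n (suc m)))

  -- On a sequence of growth rate `x`, the operator `a - T` costs at most a factor `∣a∣ + x`.
  Δ-bound : ∀ {R} K w x → (∀ m → K ℕ.≤ m → ℤ.∣ R m ∣ ℕ.≤ w ℕ.* x ℕ.^ m) →
            ∀ n m → K ℕ.≤ m → ℤ.∣ Δ n R m ∣ ℕ.≤ w ℕ.* x ℕ.^ m ℕ.* (ℤ.∣ a ∣ ℕ.+ x) ℕ.^ n
  Δ-bound K w x R≤ zero    m K≤m = ℕ.≤-trans (R≤ m K≤m) (ℕ.≤-reflexive (sym (ℕ.*-identityʳ _)))
  Δ-bound {R} K w x R≤ (suc n) m K≤m = begin
    ℤ.∣ a ℤ.* Δ n R m ℤ.- Δ n R (suc m) ∣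
      ≤⟨ ℤ.∣i-j∣≤∣i∣+∣j∣ (a ℤ.* Δ n R m) (Δ n R (suc m)) ⟩
    ℤ.∣ a ℤ.* Δ n R m ∣ ℕ.+ ℤ.∣ Δ n R (suc m) ∣
      ≡⟨ cong (ℕ._+ ℤ.∣ Δ n R (suc m) ∣) (ℤ.abs-* a (Δ n R m)) ⟩
    ℤ.∣ a ∣ ℕ.* ℤ.∣ Δ n R m ∣ ℕ.+ ℤ.∣ Δ n R (suc m) ∣
      ≤⟨ ℕ.+-mono-≤ (ℕ.*-monoʳ-≤ ℤ.∣ a ∣ (Δ-bound K w x R≤ n m K≤m))
                    (Δ-bound K w x R≤ n (suc m) (ℕ.m≤n⇒m≤1+n K≤m)) ⟩
    ℤ.∣ a ∣ ℕ.* (w ℕ.* x ℕ.^ m ℕ.* y) ℕ.+ w ℕ.* (x ℕ.* x ℕ.^ m) ℕ.* y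
      ≡⟨ solve 5 (λ a w x p y → a :* (w :* p :* y) :+ w :* (x :* p) :* y :=
                                w :* p :* ((a :+ x) :* y)) refl ℤ.∣ a ∣ w x (x ℕ.^ m) y ⟩
    w ℕ.* x ℕ.^ m ℕ.* ((ℤ.∣ a ∣ ℕ.+ x) ℕ.* y) ∎
    where
    open ℕ.≤-Reasoning
    open ℕS
    y = (ℤ.∣ a ∣ ℕ.+ x) ℕ.^ n

  -- This is two integrations by parts of y²ᵐ (r² - y²)ⁿ sin (r - y), whose boundary
  -- terms vanish for n ≥ 1.
  module Recurrence
    (c e : ℕ → ℤ) (h g : ℤ)
    (c-suc : ∀ m → c (suc m) ≡ c m ℤ.+ e m)
    (e-suc : ∀ m → e (suc m) ≡ e m ℤ.+ (h ℤ.+ h))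
    (R : ℕ → ℤ)
    (R-suc : ∀ m → R (suc m) ≡ c m ℤ.* R m ℤ.+ g ℤ.* a ℤ.^ m)
    where

    open ℤS

    -- The operator `a - T` annihilates the inhomogeneous term `g a^m`; what remains comes from the
    -- variation `e` of the coefficient `c`.
    Δ₁ : ∀ m → Δ 1 R (suc m) ≡ c m ℤ.* Δ 1 R m ℤ.- e m ℤ.* R (suc m)
    Δ₁ m = trans
      (cong (λ z → a ℤ.* R (suc m) ℤ.- z)
        (trans (R-suc (suc m)) (cong (λ z → z ℤ.* R (suc m) ℤ.+ g ℤ.* a ℤ.^ suc m) (c-suc m))))
      (trans
        (cong (λ z → a ℤ.* z ℤ.- ((c m ℤ.+ e m) ℤ.* R (suc m) ℤ.+ g ℤ.* (a ℤ.* a ℤ.^ m)))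
          (R-suc m))
        (solve 7 (λ a c e g p r s →
            a :* (c :* r :+ g :* p) :- ((c :+ e) :* s :+ g :* (a :* p)) :=
            c :* (a :* r :- s) :- e :* s)
          refl a (c m) (e m) g (a ℤ.^ m) (R m) (R (suc m))))

    -- A Leibniz rule: `c` has first difference `e` and constant second difference `2h`, so repeated
    -- differences of the product produce just three terms. The coefficients `n + 2` and
    -- `(n + 2)(n + 1)` are binomial, the latter being twice a binomial coefficient because of `2h`.
    Δ₂ : ∀ n m → Δ (2 ℕ.+ n) R (suc m) ≡
      c m ℤ.* Δ (2 ℕ.+ n) R m ℤ.- + (2 ℕ.+ n) ℤ.* e m ℤ.* Δ (1 ℕ.+ n) R (suc m)
        ℤ.+ + (2 ℕ.+ n) ℤ.* + (1 ℕ.+ n) ℤ.* h ℤ.* Δ n R (2 ℕ.+ m)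
    Δ₂ zero m = trans
      (cong₂ (λ u v → a ℤ.* u ℤ.- v) (Δ₁ m)
        (trans (Δ₁ (suc m))
          (cong₂ (λ u v → u ℤ.* Δ 1 R (suc m) ℤ.- v ℤ.* R (2 ℕ.+ m)) (c-suc m) (e-suc m))))
      (solve 7 (λ a c e h x y z →
          let w = a :* y :- z in
          a :* (c :* x :- e :* y) :- ((c :+ e) :* w :- (e :+ (h :+ h)) :* z) :=
          c :* (a :* x :- w) :- con (+ 2) :* e :* w :+ con (+ 2) :* con (+ 1) :* h :* z)
        refl a (c m) (e m) h (Δ 1 R m) (R (suc m)) (R (2 ℕ.+ m)))
    Δ₂ (suc n) m = trans
      (cong₂ (λ u v → a ℤ.* u ℤ.- v) (Δ₂ n m)
        (trans (Δ₂ n (suc m))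
          (cong₂ (λ u v → u ℤ.* Δ (2 ℕ.+ n) R (suc m)
                        ℤ.- + (2 ℕ.+ n) ℤ.* v ℤ.* Δ (1 ℕ.+ n) R (2 ℕ.+ m)
                        ℤ.+ + (2 ℕ.+ n) ℤ.* + (1 ℕ.+ n) ℤ.* h ℤ.* Δ n R (3 ℕ.+ m))
            (c-suc m) (e-suc m))))
      (solve 9 (λ a c e h n x y z t →
          let w = a :* z :- t
              v = a :* y :- w
              n₁ = con 1ℤ :+ n
              n₂ = con (+ 2) :+ n
              n₃ = con (+ 3) :+ n in
          a :* (c :* x :- n₂ :* e :* y :+ n₂ :* n₁ :* h :* z)
            :- ((c :+ e) :* v :- n₂ :* (e :+ (h :+ h)) :* w :+ n₂ :* n₁ :* h :* t) :=
          c :* (a :* x :- v) :- n₃ :* e :* v :+ n₃ :* n₂ :* h :* w)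
        refl a (c m) (e m) h (+ n) (Δ (2 ℕ.+ n) R m) (Δ (1 ℕ.+ n) R (suc m))
          (Δ n R (2 ℕ.+ m)) (Δ n R (3 ℕ.+ m)))

∣∧<⇒≡0 : ∀ {n z} → n ℕ.∣ ℤ.∣ z ∣ → ℤ.∣ z ∣ ℕ.< n → z ≡ 0ℤ
∣∧<⇒≡0 {z = z} n∣z z<n with ℤ.∣ z ∣ in eq
... | zero  = ℤ.∣i∣≡0⇒i≡0 eq
... | suc _ = contradiction n∣z (ℕ.>⇒∤ z<n)

-- Integer moments: divisibility, vanishing and descent.

module CosineForms (a b d e : ℤ) where

  open Differences a
  open ℤS

  C E : ℕ → ℤ
  C m = b ℤ.* ((+ 2 ℤ.* + m) ℤ.* (+ 2 ℤ.* + m ℤ.- 1ℤ))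
  E m = b ℤ.* (+ 8 ℤ.* + m ℤ.+ + 2)

  h : ℤ
  h = + 4 ℤ.* b

  C-suc : ∀ m → C (suc m) ≡ C m ℤ.+ E m
  C-suc m = solve 2 (λ b m →
      b :* ((con (+ 2) :* (con 1ℤ :+ m)) :* (con (+ 2) :* (con 1ℤ :+ m) :- con 1ℤ)) :=
      b :* ((con (+ 2) :* m) :* (con (+ 2) :* m :- con 1ℤ)) :+ b :* (con (+ 8) :* m :+ con (+ 2)))
    refl b (+ m)

  E-suc : ∀ m → E (suc m) ≡ E m ℤ.+ (h ℤ.+ h)
  E-suc m = solve 2 (λ b m →
      b :* (con (+ 8) :* (con 1ℤ :+ m) :+ con (+ 2)) :=
      b :* (con (+ 8) :* m :+ con (+ 2)) :+ (con (+ 4) :* b :+ con (+ 4) :* b))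
    refl b (+ m)

  -- Since `C (m + 1) = b (2m + 2)(2m + 1)`, the product `B m` of these coefficients is `b^m (2m)!`.
  C-! : ∀ m → C (suc m) ℤ.* + ((2 ℕ.* m) !) ≡ b ℤ.* + ((2 ℕ.* suc m) !)
  C-! m = sym (trans
    (cong (λ n → b ℤ.* + (n !)) (ℕ.*-suc 2 m))
    (trans
      (cong (b ℤ.*_) (trans (ℤ.pos-* (2 ℕ.+ 2 ℕ.* m) ((1 ℕ.+ 2 ℕ.* m) !))
        (cong (+ (2 ℕ.+ 2 ℕ.* m) ℤ.*_) (ℤ.pos-* (1 ℕ.+ 2 ℕ.* m) ((2 ℕ.* m) !)))))
      (trans
        (cong (λ t → b ℤ.* ((+ 2 ℤ.+ t) ℤ.* ((1ℤ ℤ.+ t) ℤ.* f))) (ℤ.pos-* 2 m))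
        (solve 3 (λ b m f →
            b :* ((con (+ 2) :+ con (+ 2) :* m) :* ((con 1ℤ :+ con (+ 2) :* m) :* f)) :=
            b :* ((con (+ 2) :* (con 1ℤ :+ m)) :* (con (+ 2) :* (con 1ℤ :+ m) :- con 1ℤ)) :* f)
          refl b (+ m) f))))
    where f = + ((2 ℕ.* m) !)

  -- The shift by one makes the recurrence of A hold from m = 0 on, where C 0 = 0, so that
  -- the divisibility by n! needs no base case in m.
  A B R : ℕ → ℤ
  A zero    = 0ℤ
  A (suc m) = C m ℤ.* A m ℤ.+ 1ℤ ℤ.* a ℤ.^ m
  B zero    = 1ℤ
  B (suc m) = C (suc m) ℤ.* B m
  R m = d ℤ.* A (suc m) ℤ.- e ℤ.* B m

  R-zero : R 0 ≡ d ℤ.- e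
  R-zero = solve 3 (λ b d e → d :* (b :* con 0ℤ :* con 0ℤ :+ con 1ℤ :* con 1ℤ) :- e :* con 1ℤ := d :- e)
    refl b d e

  R-suc : ∀ m → R (suc m) ≡ C (suc m) ℤ.* R m ℤ.+ (d ℤ.* a) ℤ.* a ℤ.^ m
  R-suc m = solve 7 (λ a d e c x y q →
      d :* (c :* x :+ con 1ℤ :* (a :* q)) :- e :* (c :* y) :=
      c :* (d :* x :- e :* y) :+ (d :* a) :* q)
    refl a d e (C (suc m)) (A (suc m)) (B m) (a ℤ.^ m)

  private
    -- The explicit factor `1ℤ` in the definition of `A` makes its recurrence the case `g = 1ℤ` by
    -- `refl`.
    module RA = Recurrence C E h 1ℤ C-suc E-suc A (λ _ → refl)
    module RR = Recurrence (λ m → C (suc m)) (λ m → E (suc m)) h (d ℤ.* a)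
                  (λ m → C-suc (suc m)) (λ m → E-suc (suc m)) R R-suc

  C0 : ∀ x → C 0 ℤ.* x ≡ 0ℤ
  C0 = solve 2 (λ b x → b :* con 0ℤ :* x := con 0ℤ) refl b

  -- In `RA.Δ₂` the two lower-order terms carry the factors `N` and `N (N - 1)`, which complete
  -- `(N - 1)!` and `(N - 2)!` to `N!`. The remaining term is handled by induction on `m`.
  !∣A-step : ∀ n → (∀ m → + (n !) ∣ Δ n A (suc m)) → (∀ m → + (suc n !) ∣ Δ (1 ℕ.+ n) A (suc m)) →
             ∀ m → + ((2 ℕ.+ n) !) ∣ Δ (2 ℕ.+ n) A (suc m)
  !∣A-step n i∣₀ i∣₁ = go
    where
    N = 2 ℕ.+ n
    !∣₁ : ∀ x {z} → + (suc n !) ∣ z → + (N !) ∣ + N ℤ.* x ℤ.* z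
    !∣₁ x {z} (divides q eq) = divides (x ℤ.* q)
      (trans (cong (+ N ℤ.* x ℤ.*_) eq)
        (trans (solve 4 (λ n x q f → n :* x :* (q :* f) := x :* q :* (n :* f))
                  refl (+ N) x q (+ (suc n !)))
          (cong (x ℤ.* q ℤ.*_) (sym (ℤ.pos-* N (suc n !))))))
    !∣₂ : ∀ x {z} → + (n !) ∣ z → + (N !) ∣ + N ℤ.* + suc n ℤ.* x ℤ.* z
    !∣₂ x {z} (divides q eq) = subst (+ (N !) ∣_)
      (solve 4 (λ n k x z → n :* x :* (k :* z) := n :* k :* x :* z) refl (+ N) (+ suc n) x z)
      (!∣₁ x (divides q (trans (cong (+ suc n ℤ.*_) eq)
        (trans (solve 3 (λ k q f → k :* (q :* f) := q :* (k :* f)) refl (+ suc n) q (+ (n !)))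
          (cong (q ℤ.*_) (sym (ℤ.pos-* (suc n) (n !))))))))
    rest : ∀ m → + (N !) ∣ C m ℤ.* Δ N A m → + (N !) ∣ Δ N A (suc m)
    rest m i∣ = subst (+ (N !) ∣_) (sym (RA.Δ₂ n m))
      (∣m∣n⇒∣m+n (∣m∣n⇒∣m-n i∣ (!∣₁ (E m) (i∣₁ m))) (!∣₂ h (i∣₀ (suc m))))
    go : ∀ m → + (N !) ∣ Δ N A (suc m)
    go zero    = rest 0 (divides 0ℤ (C0 (Δ N A 0)))
    go (suc m) = rest (suc m) (∣n⇒∣m*n (C (suc m)) (go m))

  !∣A : ∀ n m → + (n !) ∣ Δ n A (suc m)
  !∣A zero          m = divides (Δ 0 A (suc m)) (sym (ℤ.*-identityʳ _))
  !∣A (suc zero)    m = divides (Δ 1 A (suc m)) (sym (ℤ.*-identityʳ _))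
  !∣A (suc (suc n)) m = !∣A-step n (!∣A n) (!∣A (suc n)) m

  !∣! : ∀ {m n} → m ℕ.≤ n → + (m !) ∣ + (n !)
  !∣! m≤n = ∣ᵤ⇒∣ (ℕ.m≤n⇒m!∣n! m≤n)

  !∣B : ∀ m → + ((2 ℕ.* m) !) ∣ B m
  !∣B zero    = ∣-refl
  !∣B (suc m) with !∣B m
  ... | divides q eq = divides (b ℤ.* q)
    (trans (cong (C (suc m) ℤ.*_) eq)
      (trans (solve 3 (λ c q f → c :* (q :* f) := q :* (c :* f)) refl (C (suc m)) q _)
        (trans (cong (q ℤ.*_) (C-! m))
          (solve 3 (λ b q f → q :* (b :* f) := b :* q :* f) refl b q _))))

  -- The `A` part is divisible for every `m`. The `B` part is divisible by `(2m)!`, and this is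
  -- where `n ≤ m` enters.
  !∣R : ∀ n m → n ℕ.≤ m → + (n !) ∣ Δ n R m
  !∣R n m n≤m = subst (+ (n !) ∣_) (sym (Δ-linear d e (λ k → A (suc k)) B n m))
    (∣m∣n⇒∣m-n
      (∣n⇒∣m*n d (subst (+ (n !) ∣_) (sym (Δ-cong 1 (λ _ → refl) n m)) (!∣A n m)))
      (∣n⇒∣m*n e (∣-trans (!∣! (ℕ.≤-trans n≤m (ℕ.m≤m+n m _)))
        (Δ-∣ (λ k → + ((2 ℕ.* k) !)) (λ k → !∣! (ℕ.*-monoʳ-≤ 2 (ℕ.n≤1+n k))) !∣B n m))))

  -- Two consecutive zeros of `R` force `d a a^L = 0`, which `a ≢ 0ℤ` and `d ≢ 0ℤ` exclude; `b ≢ 0ℤ`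
  -- allows `h = 4b` to be cancelled in the descent.
  unbounded : a ≢ 0ℤ → b ≢ 0ℤ → d ≢ 0ℤ → ∀ K w x →
              ¬ (∀ m → K ℕ.≤ m → ℤ.∣ R m ∣ ℕ.≤ w ℕ.* x ℕ.^ m)
  unbounded a≢0 b≢0 d≢0 K w x R≤ =
    [ [ d≢0 , a≢0 ]′ ∘ ℤ.i*j≡0⇒i≡0∨j≡0 d , a≢0 ∘ ℤ.i^n≡0⇒i≡0 a L ]′
      (ℤ.i*j≡0⇒i≡0∨j≡0 (d ℤ.* a) daᴸ≡0)
    where
    y = ℤ.∣ a ∣ ℕ.+ x
    instance
      y≢0 : ℕ.NonZero y
      y≢0 = ℕ.≢-nonZero (λ y≡0 → a≢0 (ℤ.∣i∣≡0⇒i≡0 (ℕ.m+n≡0⇒m≡0 ℤ.∣ a ∣ y≡0)))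
      y³≢0 : ℕ.NonZero (y ℕ.^ 3)
      y³≢0 = ℕ.m^n≢0 y 3
    -- For `m ≤ 2n + 3` the bound `w x^m y^n` is at most `w y^(2n + 3) y^n = w′ (y³)^n`, a single
    -- geometric sequence to set against `n!`.
    w′ = w ℕ.* y ℕ.^ 3
    n₁ = proj₁ (^-<-! w′ (y ℕ.^ 3))
    n₀ = n₁ ℕ.+ K
    -- The summand `2` secures `n ≤ m` in the second starting case `n = n₀ + 1`; then
    -- `suc L = 3 + 2n₀` is the upper limit allowed in `small`.
    L = 2 ℕ.+ (n₀ ℕ.+ n₀)

    small : ∀ n m → n₀ ℕ.≤ n → n ℕ.≤ m → m ℕ.≤ 3 ℕ.+ (n ℕ.+ n) → ℤ.∣ Δ n R m ∣ ℕ.< n !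
    small n m n₀≤n n≤m m≤ = begin-strict
      ℤ.∣ Δ n R m ∣
        ≤⟨ Δ-bound K w x R≤ n m (ℕ.≤-trans (ℕ.m≤n+m K n₁) (ℕ.≤-trans n₀≤n n≤m)) ⟩
      w ℕ.* x ℕ.^ m ℕ.* y ℕ.^ n
        ≤⟨ ℕ.*-monoˡ-≤ (y ℕ.^ n) (ℕ.*-monoʳ-≤ w (ℕ.^-monoˡ-≤ m (ℕ.m≤n+m x ℤ.∣ a ∣))) ⟩
      w ℕ.* y ℕ.^ m ℕ.* y ℕ.^ n
        ≤⟨ ℕ.*-monoˡ-≤ (y ℕ.^ n) (ℕ.*-monoʳ-≤ w (ℕ.^-monoʳ-≤ y m≤)) ⟩
      w ℕ.* y ℕ.^ (3 ℕ.+ (n ℕ.+ n)) ℕ.* y ℕ.^ n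
        ≡⟨ cong (λ z → w ℕ.* z ℕ.* y ℕ.^ n) (trans (ℕ.^-distribˡ-+-* y 3 (n ℕ.+ n))
             (cong (y ℕ.^ 3 ℕ.*_) (ℕ.^-distribˡ-+-* y n n))) ⟩
      w ℕ.* (y ℕ.^ 3 ℕ.* (y ℕ.^ n ℕ.* y ℕ.^ n)) ℕ.* y ℕ.^ n
        ≡⟨ ℕS.solve 3 (λ w u v → w ℕS.:* (u ℕS.:* (v ℕS.:* v)) ℕS.:* v ℕS.:=
                                 w ℕS.:* u ℕS.:* (v ℕS.:* (v ℕS.:* (v ℕS.:* ℕS.con 1))))
             refl w (y ℕ.^ 3) (y ℕ.^ n) ⟩
      w′ ℕ.* (y ℕ.^ n) ℕ.^ 3
        ≡⟨ cong (w′ ℕ.*_) (trans (ℕ.^-*-assoc y n 3)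
             (trans (cong (y ℕ.^_) (ℕ.*-comm n 3)) (sym (ℕ.^-*-assoc y 3 n)))) ⟩
      w′ ℕ.* (y ℕ.^ 3) ℕ.^ n
        <⟨ proj₂ (^-<-! w′ (y ℕ.^ 3)) n (ℕ.≤-trans (ℕ.m≤m+n n₁ K) n₀≤n) ⟩
      n ! ∎
      where open ℕ.≤-Reasoning

    vanish : ∀ n m → n₀ ℕ.≤ n → n ℕ.≤ m → m ℕ.≤ 3 ℕ.+ (n ℕ.+ n) → Δ n R m ≡ 0ℤ
    vanish n m n₀≤n n≤m m≤ = ∣∧<⇒≡0 (∣⇒∣ᵤ (!∣R n m n≤m)) (small n m n₀≤n n≤m m≤)

    -- The window `L - n ≤ m ≤ L + 1` loses one index on the left each time `n` drops by one,
    -- exactly what the recurrence consumes. At `n = 0` it contains just `L` and `L + 1`.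
    Vanishes : ℕ → Set
    Vanishes n = ∀ m → L ℕ.≤ n ℕ.+ m → m ℕ.≤ suc L → Δ n R m ≡ 0ℤ

    start : ∀ i → i ℕ.≤ 1 → Vanishes (i ℕ.+ n₀)
    start i i≤1 m L≤ m≤ = vanish (i ℕ.+ n₀) m (ℕ.m≤n+m n₀ i)
      (ℕ.+-cancelˡ-≤ (i ℕ.+ n₀) _ _
        (ℕ.≤-trans (ℕ.≤-trans (ℕ.≤-reflexive
            (ℕS.solve 2 (λ i n → (i ℕS.:+ n) ℕS.:+ (i ℕS.:+ n) ℕS.:= (i ℕS.:+ i) ℕS.:+ (n ℕS.:+ n))
              refl i n₀))
          (ℕ.+-monoˡ-≤ (n₀ ℕ.+ n₀) (ℕ.+-mono-≤ i≤1 i≤1))) L≤))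
      (ℕ.≤-trans m≤ (ℕ.+-monoʳ-≤ 3 (ℕ.+-mono-≤ (ℕ.m≤n+m n₀ i) (ℕ.m≤n+m n₀ i))))

    step : ∀ n → n ℕ.< n₀ → Vanishes (2 ℕ.+ n) → Vanishes (1 ℕ.+ n) → Vanishes n
    -- For `m` equal to 0 or 1 the window would give `L ≤ n + 1`, impossible for `n < n₀`.
    step n n<n₀ v₂ v₁ zero L≤ _ = contradiction n<n₀ (ℕ.≤⇒≯
      (ℕ.≤-trans (ℕ.m≤n+m n₀ (2 ℕ.+ n₀)) (subst (L ℕ.≤_) (ℕ.+-identityʳ n) L≤)))
    step n n<n₀ v₂ v₁ (suc zero) L≤ _ = contradiction n<n₀ (ℕ.≤⇒≯
      (ℕ.≤-trans (ℕ.m≤n+m n₀ (1 ℕ.+ n₀)) (ℕ.s≤s⁻¹ (subst (L ℕ.≤_) (ℕ.+-comm n 1) L≤))))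
    step n n<n₀ v₂ v₁ (suc (suc m)) L≤ m≤ =
      -- The recurrence is solved for its last term, whose coefficient `(n + 2)(n + 1) h` is
      -- nonzero.
      [ (λ eq → contradiction (ℤ.i*j≡0⇒i≡0∨j≡0 (+ 4) eq) [ (λ ()) , b≢0 ]′) , id ]′ (ℤ.i*j≡0⇒i≡0∨j≡0 h
        (ℤ.*-cancelˡ-≡ (+ (2 ℕ.+ n) ℤ.* + (1 ℕ.+ n)) _ _
          (trans (solve 4 (λ u v h z → u :* v :* (h :* z) := u :* v :* h :* z)
                    refl (+ (2 ℕ.+ n)) (+ (1 ℕ.+ n)) h _)
            (trans key (sym (ℤ.*-zeroʳ (+ (2 ℕ.+ n) ℤ.* + (1 ℕ.+ n))))))))
      where
      m≤₁ = ℕ.≤-trans (ℕ.n≤1+n _) m≤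
      m≤₂ = ℕ.≤-trans (ℕ.n≤1+n _) m≤₁
      L≤₂ : L ℕ.≤ 2 ℕ.+ n ℕ.+ m
      L≤₂ = subst (L ℕ.≤_) (trans (ℕ.+-suc n (suc m)) (cong suc (ℕ.+-suc n m))) L≤
      L≤₁ : L ℕ.≤ 1 ℕ.+ n ℕ.+ suc m
      L≤₁ = subst (L ℕ.≤_) (ℕ.+-suc n (suc m)) L≤
      key : + (2 ℕ.+ n) ℤ.* + (1 ℕ.+ n) ℤ.* h ℤ.* Δ n R (2 ℕ.+ m) ≡ 0ℤ
      key = trans
        (solve 6 (λ c e n x y z → z := c :* x :- n :* e :* y :+ z :- (c :* x :- n :* e :* y))
          refl c e′ (+ (2 ℕ.+ n)) X Y Z)
        (trans (cong (ℤ._- (c ℤ.* X ℤ.- + (2 ℕ.+ n) ℤ.* e′ ℤ.* Y)) (sym (RR.Δ₂ n m)))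
          (trans
            (cong₂ ℤ._-_ (v₂ (suc m) (ℕ.≤-trans L≤₂ (ℕ.+-monoʳ-≤ (2 ℕ.+ n) (ℕ.n≤1+n m))) m≤₁)
              (cong₂ (λ u v → c ℤ.* u ℤ.- + (2 ℕ.+ n) ℤ.* e′ ℤ.* v)
                (v₂ m L≤₂ m≤₂) (v₁ (suc m) L≤₁ m≤₁)))
            (solve 3 (λ c e n → con 0ℤ :- (c :* con 0ℤ :- n :* e :* con 0ℤ) := con 0ℤ)
              refl c e′ (+ (2 ℕ.+ n)))))
        where
        c = C (suc m)
        e′ = E (suc m)
        X = Δ (2 ℕ.+ n) R m
        Y = Δ (1 ℕ.+ n) R (suc m)
        Z = + (2 ℕ.+ n) ℤ.* + (1 ℕ.+ n) ℤ.* h ℤ.* Δ n R (2 ℕ.+ m)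

    R≡0 : Vanishes 0
    R≡0 = downward Vanishes n₀ step (start 0 ℕ.z≤n) (start 1 ℕ.≤-refl)

    daᴸ≡0 : (d ℤ.* a) ℤ.* a ℤ.^ L ≡ 0ℤ
    daᴸ≡0 = trans
      (solve 3 (λ c x y → x := (c :* y :+ x) :- c :* y) refl (C (suc L)) _ (R L))
      (trans (cong₂ (λ u v → u ℤ.- C (suc L) ℤ.* v)
          (trans (sym (R-suc L)) (R≡0 (suc L) (ℕ.n≤1+n L) ℕ.≤-refl)) (R≡0 L ℕ.≤-refl (ℕ.n≤1+n L)))
        (solve 1 (λ c → con 0ℤ :- c :* con 0ℤ := con 0ℤ) refl (C (suc L))))

-- Integers inside the rationals, and factorial inequalities.

κ : ℤ → ℚ
κ z = z ℚ./ 1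

κ-+ : ∀ x y → κ (x ℤ.+ y) ≡ κ x ℚ.+ κ y
κ-+ x y = sym (trans (fromℚᵘ-homo-+ (mkℚᵘ x 0) (mkℚᵘ y 0))
  (ℚ.fromℚᵘ-cong {mkℚᵘ x 0 ℚᵘ.+ mkℚᵘ y 0} {mkℚᵘ (x ℤ.+ y) 0}
    (*≡* (cong (ℤ._* 1ℤ) (cong₂ ℤ._+_ (ℤ.*-identityʳ x) (ℤ.*-identityʳ y))))))

κ-* : ∀ x y → κ (x ℤ.* y) ≡ κ x ℚ.* κ y
κ-* x y = sym (fromℚᵘ-homo-* (mkℚᵘ x 0) (mkℚᵘ y 0))

κ-minus : ∀ x y → κ (x ℤ.- y) ≡ κ x ℚ.- κ y
κ-minus x y = trans (solve 2 (λ u v → u := (u :+ v) :- v) refl (κ (x ℤ.- y)) (κ y))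
  (cong (ℚ._- κ y) (trans (sym (κ-+ (x ℤ.- y) y))
    (cong κ (ℤS.solve 2 (λ x y → x ℤS.:- y ℤS.:+ y ℤS.:= x) refl x y))))
  where open ℚS

κ-^ : ∀ x n → κ (x ℤ.^ n) ≡ pow (κ x) n
κ-^ x zero    = refl
κ-^ x (suc n) = trans (κ-* x (x ℤ.^ n)) (cong (κ x ℚ.*_) (κ-^ x n))

∣κ∣ : ∀ z → ∣ κ z ∣ ≡ ι ℤ.∣ z ∣
∣κ∣ (+ n)         = ℚ.0≤p⇒∣p∣≡p (ι-nonNeg n)
∣κ∣ (ℤ.-[1+ n ]) = trans (ℚ.∣-p∣≡∣p∣ (ι (suc n))) (ℚ.0≤p⇒∣p∣≡p (ι-nonNeg (suc n)))

ι-* : ∀ m n → ι (m ℕ.* n) ≡ ι m ℚ.* ι n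
ι-* m n = trans (cong κ (ℤ.pos-* m n)) (κ-* (+ m) (+ n))

ι-^ : ∀ m n → ι (m ℕ.^ n) ≡ pow (ι m) n
ι-^ m zero    = refl
ι-^ m (suc n) = trans (ι-* m (m ℕ.^ n)) (cong (ι m ℚ.*_) (ι-^ m n))

ι-cancel-≤ : ∀ {m n} → ι m ℚ.≤ ι n → m ℕ.≤ n
ι-cancel-≤ {m} {n} ιm≤ιn = ℕ.≮⇒≥ λ n<m → ℚ.<-irrefl refl
  (ℚ.<-≤-trans (subst (ℚ._< ι n ℚ.+ 1ℚ) (ℚ.+-identityʳ (ι n)) (ℚ.+-monoʳ-< (ι n) 0<1))
    (ℚ.≤-trans (ℚ.≤-reflexive (trans (ℚ.+-comm (ι n) 1ℚ) (sym (ι-suc n))))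
      (ℚ.≤-trans (ι-mono n<m) ιm≤ιn)))

↧*p≡↥ : ∀ p → κ (↧ p) ℚ.* p ≡ κ (↥ p)
↧*p≡↥ p@(ℚ.mkℚ x y _) = trans (cong (κ (↧ p) ℚ.*_) (sym (ℚ.fromℚᵘ-toℚᵘ p)))
  (trans (fromℚᵘ-homo-* (mkℚᵘ (↧ p) 0) (toℚᵘ p))
    (ℚ.fromℚᵘ-cong {mkℚᵘ (↧ p) 0 ℚᵘ.* toℚᵘ p} {mkℚᵘ x 0}
      (*≡* (solve 2 (λ d n → d :* n :* con 1ℤ := n :* (con 1ℤ :* d)) refl (↧ p) x))))
  where open ℤS

pow-distribˡ-* : ∀ n p q → pow (p ℚ.* q) n ≡ pow p n ℚ.* pow q n
pow-distribˡ-* zero    p q = refl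
pow-distribˡ-* (suc n) p q = trans (cong (p ℚ.* q ℚ.*_) (pow-distribˡ-* n p q))
  (solve 4 (λ p q x y → p :* q :* (x :* y) := p :* x :* (q :* y)) refl p q (pow p n) (pow q n))
  where open ℚS

pow-monoˡ : ∀ {p q} → 0ℚ ℚ.≤ p → p ℚ.≤ q → ∀ n → pow p n ℚ.≤ pow q n
pow-monoˡ 0≤p p≤q zero    = ℚ.≤-refl
pow-monoˡ 0≤p p≤q (suc n) =
  mono* (pow-nonNeg 0≤p n) (ℚ.≤-trans 0≤p p≤q) p≤q (pow-monoˡ 0≤p p≤q n)

!*inv! : ∀ n → ι (n !) ℚ.* inv! n ≡ 1ℚ
!*inv! zero    = refl
!*inv! (suc n) = trans (cong (ℚ._* inv! (suc n)) (ι-* (suc n) (n !)))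
  (trans (solve 3 (λ s f i → s :* f :* i := f :* (s :* i)) refl (ι (suc n)) (ι (n !)) (inv! (suc n)))
    (trans (cong (ι (n !) ℚ.*_) (inv!-suc n)) (!*inv! n)))
  where open ℚS

inv!-suc-≤ : ∀ n → inv! (suc n) ℚ.≤ inv! n
inv!-suc-≤ n = subst₂ ℚ._≤_ (ℚ.*-identityˡ (inv! (suc n))) (inv!-suc n)
  (monoʳ (inv! (suc n)) (inv!-nonNeg (suc n)) (1≤ι-suc n))

-- If `q < p`, then half of the gap `p - q` is an `ε` violating the hypothesis.
≤-approx : ∀ {p q} → (∀ ε → 0ℚ ℚ.< ε → p ℚ.≤ q ℚ.+ ε) → p ℚ.≤ q
≤-approx {p} {q} approx = ℚ.≮⇒≥ λ q<p →
  let 0<d = subst (ℚ._< p ℚ.- q) (ℚ.+-inverseʳ q) (ℚ.+-monoˡ-< (ℚ.- q) q<p) in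
  ℚ.<-irrefl refl (ℚ.<-≤-trans
    (subst₂ ℚ._<_ (ℚ.+-identityʳ (q ℚ.+ half (p ℚ.- q)))
      (trans (ℚ.+-assoc q _ _) (trans (cong (q ℚ.+_) (half+half (p ℚ.- q)))
        (solve 2 (λ p q → q :+ (p :- q) := p) refl p q)))
      (ℚ.+-monoʳ-< (q ℚ.+ half (p ℚ.- q)) (half-pos 0<d)))
    (approx (half (p ℚ.- q)) (half-pos 0<d)))
  where open ℚS

-- Rational limits, and the cosine partial sums as rationals.

infix 4 _⇢_ _⇢ᶜ_

-- A record rather than a bare function type, so that unification can recover `u` and `p`.
record _⇢_ (u : ℕ → ℚ) (p : ℚ) : Set where
  constructor ⇢-intro
  field
    eventually : ∀ ε → 0ℚ ℚ.< ε → ∃ λ N → ∀ n → N ℕ.≤ n → dist (u n) p ℚ.< ε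

open _⇢_

⇢-const : ∀ p → (λ _ → p) ⇢ p
⇢-const p = ⇢-intro λ ε 0<ε →
  0 , λ _ _ → subst (ℚ._< ε) (cong ∣_∣ (sym (ℚ.+-inverseʳ p))) 0<ε

⇢-resp : ∀ {u v p q} → (∀ n → u n ≡ v n) → p ≡ q → u ⇢ p → v ⇢ q
⇢-resp u≡v p≡q u⇢p = ⇢-intro λ ε 0<ε →
  let (N , close) = eventually u⇢p ε 0<ε in
  N , λ n N≤n → subst (ℚ._< ε) (cong₂ dist (u≡v n) p≡q) (close n N≤n)

⇢-+ : ∀ {u v p q} → u ⇢ p → v ⇢ q → (λ n → u n ℚ.+ v n) ⇢ p ℚ.+ q
⇢-+ {u} {v} {p} {q} u⇢p v⇢q = ⇢-intro λ ε 0<ε →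
  let (M , cM) = eventually u⇢p (half ε) (half-pos 0<ε)
      (N , cN) = eventually v⇢q (half ε) (half-pos 0<ε)
  in M ℕ.+ N , λ n ≤n → ℚ.≤-<-trans
    (subst (λ z → ∣ z ∣ ℚ.≤ dist (u n) p ℚ.+ dist (v n) q)
      (solve 4 (λ a b c d → (a :- b) :+ (c :- d) := (a :+ c) :- (b :+ d)) refl (u n) p (v n) q)
      (ℚ.∣p+q∣≤∣p∣+∣q∣ (u n ℚ.- p) (v n ℚ.- q)))
    (<-halves (cM n (ℕ.m+n≤o⇒m≤o M ≤n)) (cN n (ℕ.m+n≤o⇒n≤o M ≤n)))
  where open ℚS

⇢-neg : ∀ {u p} → u ⇢ p → (λ n → ℚ.- u n) ⇢ ℚ.- p
⇢-neg {u} {p} u⇢p = ⇢-intro λ ε 0<ε →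
  let (N , close) = eventually u⇢p ε 0<ε in
  N , λ n N≤n → subst (ℚ._< ε)
    (trans (sym (ℚ.∣-p∣≡∣p∣ (u n ℚ.- p))) (cong ∣_∣ (ℚ.neg-distrib-+ (u n) (ℚ.- p))))
    (close n N≤n)

⇢-scale : ∀ {u p} (b : ℕ → ℚ) c → 0ℚ ℚ.< c → (∀ n → ∣ b n ∣ ℚ.≤ c) → u ⇢ p →
          (λ n → (u n ℚ.- p) ℚ.* b n) ⇢ 0ℚ
⇢-scale {u} {p} b c 0<c b≤c u⇢p = ⇢-intro λ ε 0<ε →
  let (N , close) = eventually u⇢p (ε ℚ.* ℚ.1/ c)
        (pos* 0<ε (ℚ.positive⁻¹ (ℚ.1/ c) {{ℚ.1/pos⇒pos c}}))
  in N , λ n N≤n → subst (ℚ._< ε) (cong ∣_∣ (sym (ℚ.+-identityʳ ((u n ℚ.- p) ℚ.* b n))))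
    (ℚ.≤-<-trans
      (ℚ.≤-trans (ℚ.≤-reflexive (ℚ.∣p*q∣≡∣p∣*∣q∣ (u n ℚ.- p) (b n)))
        (monoˡ (dist (u n) p) (ℚ.0≤∣p∣ (u n ℚ.- p)) (b≤c n)))
      (subst (dist (u n) p ℚ.* c ℚ.<_)
        (trans (ℚ.*-assoc ε (ℚ.1/ c) c)
          (trans (cong (ε ℚ.*_) (ℚ.*-inverseˡ c)) (ℚ.*-identityʳ ε)))
        (ℚ.*-monoˡ-<-pos c (close n N≤n))))
  where
  instance
    c-positive : ℚ.Positive c
    c-positive = ℚ.positive 0<c
    c-nonZero : ℚ.NonZero c
    c-nonZero = ℚ.pos⇒nonZero c

-- Uses `uv - pq = (u - p) v + (v - q) p`, with `seq-bounded` bounding `v`. Adding `1ℚ` to each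
-- bound keeps it positive, as `⇢-scale` divides by it.
⇢-* : ∀ x y {p q} → seq x ⇢ p → seq y ⇢ q → seq (x *ᴿ y) ⇢ p ℚ.* q
⇢-* x y {p} {q} x⇢p y⇢q = ⇢-resp
  (λ n → solve 4 (λ u v p q → (u :- p) :* v :+ (v :- q) :* p :+ p :* q := u :* v)
    refl (seq x n) (seq y n) p q)
  (solve 2 (λ p q → con 0ℚ :+ con 0ℚ :+ p :* q := p :* q) refl p q)
  (⇢-+ (⇢-+ (⇢-scale (seq y) (B ℚ.+ 1ℚ) (ℚ.<-≤-trans 0<1 (≤+ˡ B≥0))
               (λ n → ℚ.≤-trans (y≤B n) (≤+ʳ 0≤1)) x⇢p)
            (⇢-scale (λ _ → p) (∣ p ∣ ℚ.+ 1ℚ) (ℚ.<-≤-trans 0<1 (≤+ˡ (ℚ.0≤∣p∣ p)))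
               (λ _ → ≤+ʳ 0≤1) y⇢q))
       (⇢-const (p ℚ.* q)))
  where
  open ℚS
  B = proj₁ (seq-bounded y)
  B≥0 = proj₁ (proj₂ (seq-bounded y))
  y≤B = proj₂ (proj₂ (seq-bounded y))

-- The content is that of `z ≈ ℚ→ℂ p`, phrased through limits of the approximating sequences.
record _⇢ᶜ_ (z : ℂ) (p : ℚ) : Set where
  constructor _+i_
  field
    re-⇢ : seq (re z) ⇢ p
    im-⇢ : seq (im z) ⇢ 0ℚ

open _⇢ᶜ_

⇢ᶜ-ℚ : ∀ p → ℚ→ℂ p ⇢ᶜ p
⇢ᶜ-ℚ p = ⇢-const p +i ⇢-const 0ℚ

≈⇒⇢ᶜ : ∀ {z p} → z ≈ ℚ→ℂ p → z ⇢ᶜ p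
≈⇒⇢ᶜ (re≈ , im≈) = ⇢-intro re≈ +i ⇢-intro im≈

⇢ᶜ-+ : ∀ z w {p q} → z ⇢ᶜ p → w ⇢ᶜ q → z + w ⇢ᶜ p ℚ.+ q
⇢ᶜ-+ z w (a +i b) (c +i d) = ⇢-+ a c +i ⇢-+ b d

⇢ᶜ-* : ∀ z w {p q} → z ⇢ᶜ p → w ⇢ᶜ q → z * w ⇢ᶜ p ℚ.* q
⇢ᶜ-* z w {p} {q} (a +i b) (c +i d) =
  ⇢-resp (λ _ → refl) (solve 2 (λ p q → p :* q :- con 0ℚ :* con 0ℚ := p :* q) refl p q)
    (⇢-+ (⇢-* (re z) (re w) a c) (⇢-neg (⇢-* (im z) (im w) b d)))
  +i
  ⇢-resp (λ _ → refl) (solve 2 (λ p q → p :* con 0ℚ :+ con 0ℚ :* q := con 0ℚ) refl p q)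
    (⇢-+ (⇢-* (re z) (im w) a d) (⇢-* (im z) (re w) b c))
  where open ℚS

private

  1-re : ∀ a b → a ℚ.* 1ℚ ℚ.- b ℚ.* 0ℚ ≡ a
  1-re = solve 2 (λ a b → a :* con 1ℚ :- b :* con 0ℚ := a) refl
    where open ℚS

  1-im : ∀ a b → a ℚ.* 0ℚ ℚ.+ b ℚ.* 1ℚ ≡ b
  1-im = solve 2 (λ a b → a :* con 0ℚ :+ b :* con 1ℚ := b) refl
    where open ℚS

  ^-2+-re : ∀ z k n → seq (re (z ^ 2 * z ^ k)) n ≡ seq (re (z ^ (2 ℕ.+ k))) n
  ^-2+-re z k n = trans
    (cong₂ (λ x y → (a ℚ.* x ℚ.- b ℚ.* y) ℚ.* c ℚ.- (a ℚ.* y ℚ.+ b ℚ.* x) ℚ.* d)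
      (1-re a b) (1-im a b))
    (solve 4 (λ a b c d → (a :* a :- b :* b) :* c :- (a :* b :+ b :* a) :* d :=
                          a :* (a :* c :- b :* d) :- b :* (a :* d :+ b :* c)) refl a b c d)
    where
    open ℚS
    a = seq (re z) n
    b = seq (im z) n
    c = seq (re (z ^ k)) n
    d = seq (im (z ^ k)) n

  ^-2+-im : ∀ z k n → seq (im (z ^ 2 * z ^ k)) n ≡ seq (im (z ^ (2 ℕ.+ k))) n
  ^-2+-im z k n = trans
    (cong₂ (λ x y → (a ℚ.* x ℚ.- b ℚ.* y) ℚ.* d ℚ.+ (a ℚ.* y ℚ.+ b ℚ.* x) ℚ.* c)
      (1-re a b) (1-im a b))
    (solve 4 (λ a b c d → (a :* a :- b :* b) :* d :+ (a :* b :+ b :* a) :* c :=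
                          a :* (a :* d :+ b :* c) :+ b :* (a :* c :- b :* d)) refl a b c d)
    where
    open ℚS
    a = seq (re z) n
    b = seq (im z) n
    c = seq (re (z ^ k)) n
    d = seq (im (z ^ k)) n

-- The operations on `ℝ` act entrywise on `seq`, so this regrouping is an exact identity of
-- rationals at each index.
⇢ᶜ-^-2+ : ∀ z k {p} → z ^ 2 * z ^ k ⇢ᶜ p → z ^ (2 ℕ.+ k) ⇢ᶜ p
⇢ᶜ-^-2+ z k lim =
  ⇢-resp {seq (re (z ^ 2 * z ^ k))} {seq (re (z ^ (2 ℕ.+ k)))} (^-2+-re z k) refl (re-⇢ lim) +i
  ⇢-resp {seq (im (z ^ 2 * z ^ k))} {seq (im (z ^ (2 ℕ.+ k)))} (^-2+-im z k) refl (im-⇢ lim)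

-- Only `z ^ 2` is known to be rational, so the power grows by two factors at a time.
⇢ᶜ-^ : ∀ z {q} → z ^ 2 ⇢ᶜ q → ∀ k → z ^ (2 ℕ.* k) ⇢ᶜ pow q k
⇢ᶜ-^ z z²⇢q zero = ⇢ᶜ-ℚ 1ℚ
⇢ᶜ-^ z {q} z²⇢q (suc k) =
  subst (λ n → z ^ n ⇢ᶜ pow q (suc k)) {y = 2 ℕ.* suc k} (sym (ℕ.*-suc 2 k))
    (⇢ᶜ-^-2+ z (2 ℕ.* k) (⇢ᶜ-* (z ^ 2) (z ^ (2 ℕ.* k)) z²⇢q (⇢ᶜ-^ z z²⇢q k)))

-- Partial sums of cos √(-u).
S : ℚ → ℕ → ℚ
S u zero    = 0ℚ
S u (suc k) = S u k ℚ.+ inv! (2 ℕ.* k) ℚ.* pow u k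

cosCoeff≡ : ∀ k → cosCoeff k ≡ κ (ℤ.-1ℤ ℤ.^ k) ℚ.* inv! (2 ℕ.* k)
cosCoeff≡ k with ℤ.-1ℤ ℤ.^ k | -1^ k
... | _ | inj₁ refl = sym (ℚ.*-identityˡ (inv! (2 ℕ.* k)))
... | _ | inj₂ refl = solve 1 (λ x → :- x := con (ℚ.- 1ℚ) :* x) refl (inv! (2 ℕ.* k))
  where open ℚS

-- The sign `(-1)^k` is absorbed into the base, turning `q` into `-q`.
cosCoeff*pow : ∀ q k → cosCoeff k ℚ.* pow q k ≡ inv! (2 ℕ.* k) ℚ.* pow (ℚ.- q) k
cosCoeff*pow q k = trans (cong (ℚ._* pow q k) (cosCoeff≡ k))
  (trans (solve 3 (λ s i x → s :* i :* x := i :* (s :* x)) refl (κ (ℤ.-1ℤ ℤ.^ k)) (inv! (2 ℕ.* k)) (pow q k))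
    (cong (inv! (2 ℕ.* k) ℚ.*_)
      (trans (cong (ℚ._* pow q k) (κ-^ ℤ.-1ℤ k))
        (trans (sym (pow-distribˡ-* k (ℚ.- 1ℚ) q))
          (cong (λ v → pow v k) (solve 1 (λ q → con (ℚ.- 1ℚ) :* q := :- q) refl q))))))
  where open ℚS

cosPartial⇢S : ∀ r {q} → r ^ 2 ⇢ᶜ q → ∀ n → cosPartial r n ⇢ᶜ S (ℚ.- q) n
cosPartial⇢S r r²⇢q zero = ⇢ᶜ-ℚ 0ℚ
cosPartial⇢S r {q} r²⇢q (suc n) = ⇢ᶜ-+ (cosPartial r n) (cosTerm r n) (cosPartial⇢S r r²⇢q n)
  (subst (cosTerm r n ⇢ᶜ_) (cosCoeff*pow q n)
    (⇢ᶜ-* (ℚ→ℂ (cosCoeff n)) (r ^ (2 ℕ.* n)) (⇢ᶜ-ℚ (cosCoeff n)) (⇢ᶜ-^ r r²⇢q n)))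

-- The integer moments as scaled errors of the partial sums.

module CosineFormsℚ (u p : ℚ) where

  open CosineForms (↥ u) (↧ u) (↧ p) (↥ p) public
  open ℚS

  private
    a^ : ∀ m → κ ((↥ u) ℤ.^ m) ≡ pow (κ (↧ u)) m ℚ.* pow u m
    a^ m = trans (κ-^ (↥ u) m)
      (trans (cong (λ v → pow v m) (sym (↧*p≡↥ u))) (pow-distribˡ-* m (κ (↧ u)) u))

    C-!ℚ : ∀ m → κ (C (suc m)) ℚ.* ι ((2 ℕ.* m) !) ≡ κ (↧ u) ℚ.* ι ((2 ℕ.* suc m) !)
    C-!ℚ m = trans (sym (κ-* (C (suc m)) (+ ((2 ℕ.* m) !))))
      (trans (cong κ (C-! m)) (κ-* (↧ u) (+ ((2 ℕ.* suc m) !))))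

  -- In the induction `C (m + 1)` upgrades `b^m (2m)!` to `b^(m + 1) (2m + 2)!`, and the
  -- inhomogeneous term `d a^(m + 1) = d b^(m + 1) u^(m + 1)` supplies the next summand of `S`.
  κR : ∀ m → κ (R m) ≡
       κ (↧ p) ℚ.* pow (κ (↧ u)) m ℚ.* ι ((2 ℕ.* m) !) ℚ.* (S u (suc m) ℚ.- p)
  κR zero = trans (cong κ R-zero)
    (trans (κ-minus (↧ p) (↥ p))
      (trans (cong (λ v → κ (↧ p) ℚ.- v) (sym (↧*p≡↥ p)))
        (solve 2 (λ d p → d :- d :* p :=
            d :* con 1ℚ :* con 1ℚ :* ((con 0ℚ :+ con 1ℚ :* con 1ℚ) :- p))
          refl (κ (↧ p)) p)))
  κR (suc m) = begin
    κ (R (suc m))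
      ≡⟨ cong κ (R-suc m) ⟩
    κ (C (suc m) ℤ.* R m ℤ.+ (↧ p ℤ.* ↥ u) ℤ.* (↥ u) ℤ.^ m)
      ≡⟨ κ-+ (C (suc m) ℤ.* R m) _ ⟩
    κ (C (suc m) ℤ.* R m) ℚ.+ κ ((↧ p ℤ.* ↥ u) ℤ.* (↥ u) ℤ.^ m)
      ≡⟨ cong₂ ℚ._+_ (trans (κ-* (C (suc m)) (R m)) (cong (κ (C (suc m)) ℚ.*_) (κR m)))
           (trans (cong κ (ℤ.*-assoc (↧ p) (↥ u) ((↥ u) ℤ.^ m)))
             (trans (κ-* (↧ p) ((↥ u) ℤ.^ suc m)) (cong (d ℚ.*_) (a^ (suc m))))) ⟩
    c ℚ.* (d ℚ.* β ℚ.* f ℚ.* (s ℚ.- p)) ℚ.+ d ℚ.* (b ℚ.* β ℚ.* v)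
      ≡⟨ solve 8 (λ c d β f s p b v →
           c :* (d :* β :* f :* (s :- p)) :+ d :* (b :* β :* v) :=
           d :* β :* (c :* f) :* (s :- p) :+ d :* (b :* β) :* v :* con 1ℚ) refl c d β f s p b v ⟩
    d ℚ.* β ℚ.* (c ℚ.* f) ℚ.* (s ℚ.- p) ℚ.+ d ℚ.* (b ℚ.* β) ℚ.* v ℚ.* 1ℚ
      ≡⟨ cong₂ (λ x y → d ℚ.* β ℚ.* x ℚ.* (s ℚ.- p) ℚ.+ d ℚ.* (b ℚ.* β) ℚ.* v ℚ.* y)
           (C-!ℚ m) (sym (!*inv! (2 ℕ.* suc m))) ⟩
    d ℚ.* β ℚ.* (b ℚ.* f′) ℚ.* (s ℚ.- p) ℚ.+ d ℚ.* (b ℚ.* β) ℚ.* v ℚ.* (f′ ℚ.* i)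
      ≡⟨ solve 8 (λ d β b f′ s p v i →
           d :* β :* (b :* f′) :* (s :- p) :+ d :* (b :* β) :* v :* (f′ :* i) :=
           d :* (b :* β) :* f′ :* (s :+ i :* v :- p)) refl d β b f′ s p v i ⟩
    d ℚ.* (b ℚ.* β) ℚ.* f′ ℚ.* (s ℚ.+ i ℚ.* v ℚ.- p) ∎
    where
    open ≡-Reasoning
    b = κ (↧ u)
    c = κ (C (suc m))
    d = κ (↧ p)
    β = pow b m
    f = ι ((2 ℕ.* m) !)
    f′ = ι ((2 ℕ.* suc m) !)
    i = inv! (2 ℕ.* suc m)
    s = S u (suc m)
    v = pow u (suc m)

-- Geometric bound on the moments, and the contradiction.

module _ {r : ℂ} {q p : ℚ} (r²⇢q : r ^ 2 ⇢ᶜ q) (cos⇢p : cos r ⇢ᶜ p) where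

  open Majorant r

  -- `tail-bound` controls the entries of the partial sums uniformly in the index `j`. The limits
  -- are compared at one common `j`, at a cost of `ε` in total, which `≤-approx` removes.
  S-tail : ∀ m → K ℕ.≤ m → dist (S (ℚ.- q) m) p ℚ.≤ t m ℚ.+ t m
  S-tail m K≤m = ≤-approx λ ε 0<ε →
    let
      0<ε/2 = half-pos 0<ε
      0<ε/4 = half-pos 0<ε/2
      (N , N-close) = proj₁ (cos-converges r) (half (half ε)) 0<ε/4
      -- Adding `m` gives the form `N + m` in which `tail-bound` compares with index `m`.
      n = N ℕ.+ m
      (J₁ , close₁) = N-close n (ℕ.m≤m+n N m)
      (J₂ , close₂) = eventually (re-⇢ (cosPartial⇢S r r²⇢q m)) (half ε) 0<ε/2
      (J₃ , close₃) = eventually (re-⇢ cos⇢p) (half (half ε)) 0<ε/4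
      j = J₁ ℕ.+ (J₂ ℕ.+ J₃)
      J₁≤j = ℕ.m≤m+n J₁ (J₂ ℕ.+ J₃)
      J₂≤j = ℕ.≤-trans (ℕ.m≤m+n J₂ J₃) (ℕ.m≤n+m (J₂ ℕ.+ J₃) J₁)
      J₃≤j = ℕ.≤-trans (ℕ.m≤n+m J₃ J₂) (ℕ.m≤n+m (J₂ ℕ.+ J₃) J₁)
      u = λ k → seq (re (cosPartial r k)) j
      s = S (ℚ.- q) m
      first = subst (ℚ._≤ half ε) (dist-sym (u m) s) (ℚ.<⇒≤ (close₂ j J₂≤j))
      last = ℚ.<⇒≤ (via (u n) (seq (re (cos r)) j) p (close₁ j J₁≤j) (close₃ j J₃≤j))
      middle = subst (ℚ._≤ t m ℚ.+ t m) (dist-sym (u n) (u m))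
        (ℚ.≤-trans (tail-bound {K} {t} {u} (re-step j) t-halving m K≤m N)
          (ℚ.≤-trans
            (ℚ.+-monoʳ-≤ (t m ℚ.+ t m) (ℚ.neg-antimono-≤ (nonNeg+ (t≥0 n) (t≥0 n))))
            (ℚ.≤-reflexive (ℚ.+-identityʳ (t m ℚ.+ t m)))))
    in ℚ.≤-trans (dist-triangle s (u m) p)
        (ℚ.≤-trans
          (ℚ.+-mono-≤ first (ℚ.≤-trans (dist-triangle (u m) (u n) p) (ℚ.+-mono-≤ middle last)))
          (ℚ.≤-reflexive (trans
            (solve 2 (λ h t → h :+ (t :+ h) := t :+ (h :+ h)) refl (half ε) (t m ℚ.+ t m))
            (cong (t m ℚ.+ t m ℚ.+_) (half+half ε)))))
    where open ℚS


  open CosineFormsℚ (ℚ.- q) p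

  private
    b d x : ℕ
    b = ↧ₙ (ℚ.- q)
    d = ↧ₙ p
    x = proj₁ (ceil M)

  -- By `κR` and `S-tail` the bound is `d b^m (2m)!` times twice `M^(2m + 2) / (2m + 2)!`. The
  -- factorials have quotient at most 1, leaving geometric growth once `M` is rounded up to `x`.
  R-bound : ∀ m → K ℕ.≤ m → ℤ.∣ R m ∣ ℕ.≤ d ℕ.* (x ℕ.* x) ℕ.* 2 ℕ.* (b ℕ.* (x ℕ.* x)) ℕ.^ m
  R-bound m K≤m = ι-cancel-≤ (begin
    ι ℤ.∣ R m ∣
      ≡⟨ sym (∣κ∣ (R m)) ⟩
    ∣ κ (R m) ∣
      ≡⟨ cong ∣_∣ (κR m) ⟩
    ∣ ι d ℚ.* pow (ι b) m ℚ.* f ℚ.* (s ℚ.- p) ∣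
      ≡⟨ trans (ℚ.∣p*q∣≡∣p∣*∣q∣ (ι d ℚ.* pow (ι b) m ℚ.* f) (s ℚ.- p))
           (cong (ℚ._* dist s p) (ℚ.0≤p⇒∣p∣≡p coeff≥0)) ⟩
    ι d ℚ.* pow (ι b) m ℚ.* f ℚ.* dist s p
      ≤⟨ monoˡ _ coeff≥0 (S-tail (suc m) (ℕ.m≤n⇒m≤1+n K≤m)) ⟩
    ι d ℚ.* pow (ι b) m ℚ.* f ℚ.* (i ℚ.* pow M n ℚ.+ i ℚ.* pow M n)
      ≡⟨ solve 5 (λ d β f i y → d :* β :* f :* (i :* y :+ i :* y) := (f :* i) :* (d :* β :* (y :+ y)))
           refl (ι d) (pow (ι b) m) f i (pow M n) ⟩
    (f ℚ.* i) ℚ.* (ι d ℚ.* pow (ι b) m ℚ.* (pow M n ℚ.+ pow M n))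
      ≤⟨ mono* (nonNeg* dβ≥0 (nonNeg+ (pow-nonNeg M≥0 n) (pow-nonNeg M≥0 n))) 0≤1 fi≤1
           (monoˡ _ dβ≥0 (ℚ.+-mono-≤ M^≤ M^≤)) ⟩
    1ℚ ℚ.* (ι d ℚ.* pow (ι b) m ℚ.* (pow (ι x) n ℚ.+ pow (ι x) n))
      ≡⟨ solve 3 (λ d β y → con 1ℚ :* (d :* β :* (y :+ y)) := d :* β :* y :* con (ι 2))
           refl (ι d) (pow (ι b) m) (pow (ι x) n) ⟩
    ι d ℚ.* pow (ι b) m ℚ.* pow (ι x) n ℚ.* ι 2
      ≡⟨ cong (ℚ._* ι 2) (cong₂ (λ y z → ι d ℚ.* y ℚ.* z) (sym (ι-^ b m)) (sym (ι-^ x n))) ⟩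
    ι d ℚ.* ι (b ℕ.^ m) ℚ.* ι (x ℕ.^ n) ℚ.* ι 2
      ≡⟨ sym (trans (ι-* (d ℕ.* b ℕ.^ m ℕ.* x ℕ.^ n) 2) (cong (ℚ._* ι 2)
           (trans (ι-* (d ℕ.* b ℕ.^ m) (x ℕ.^ n)) (cong (ℚ._* ι (x ℕ.^ n)) (ι-* d (b ℕ.^ m)))))) ⟩
    ι (d ℕ.* b ℕ.^ m ℕ.* x ℕ.^ n ℕ.* 2)
      ≡⟨ cong ι regroup ⟩
    ι (d ℕ.* (x ℕ.* x) ℕ.* 2 ℕ.* (b ℕ.* (x ℕ.* x)) ℕ.^ m) ∎)
    where
    open ℚ.≤-Reasoning
    open ℚS
    n = 2 ℕ.* suc m
    f = ι ((2 ℕ.* m) !)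
    i = inv! n
    s = S (ℚ.- q) (suc m)
    dβ≥0 : 0ℚ ℚ.≤ ι d ℚ.* pow (ι b) m
    dβ≥0 = nonNeg* (ι-nonNeg d) (pow-nonNeg (ι-nonNeg b) m)
    coeff≥0 : 0ℚ ℚ.≤ ι d ℚ.* pow (ι b) m ℚ.* f
    coeff≥0 = nonNeg* dβ≥0 (ι-nonNeg ((2 ℕ.* m) !))
    M^≤ : pow M n ℚ.≤ pow (ι x) n
    M^≤ = pow-monoˡ M≥0 (proj₂ (ceil M)) n
    fi≤1 : f ℚ.* i ℚ.≤ 1ℚ
    fi≤1 = ℚ.≤-trans
      (monoˡ f (ι-nonNeg ((2 ℕ.* m) !))
        (subst (λ k → inv! k ℚ.≤ inv! (2 ℕ.* m)) (sym (ℕ.*-suc 2 m))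
          (ℚ.≤-trans (inv!-suc-≤ (1 ℕ.+ 2 ℕ.* m)) (inv!-suc-≤ (2 ℕ.* m)))))
      (ℚ.≤-reflexive (!*inv! (2 ℕ.* m)))
    regroup : d ℕ.* b ℕ.^ m ℕ.* x ℕ.^ n ℕ.* 2 ≡
              d ℕ.* (x ℕ.* x) ℕ.* 2 ℕ.* (b ℕ.* (x ℕ.* x)) ℕ.^ m
    regroup = trans
      (cong (λ z → d ℕ.* b ℕ.^ m ℕ.* z ℕ.* 2)
        (trans (sym (ℕ.^-*-assoc x 2 (suc m)))
          (cong (λ z → (x ℕ.* z) ℕ.^ suc m) (ℕ.*-identityʳ x))))
      (trans
        (ℕS.solve 4 (λ d β y z → d ℕS.:* β ℕS.:* (y ℕS.:* z) ℕS.:* ℕS.con 2 ℕS.:=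
                                 d ℕS.:* y ℕS.:* ℕS.con 2 ℕS.:* (β ℕS.:* z))
          refl d (b ℕ.^ m) (x ℕ.* x) ((x ℕ.* x) ℕ.^ m))
        (cong (d ℕ.* (x ℕ.* x) ℕ.* 2 ℕ.*_) (sym (^-distribˡ-* m b (x ℕ.* x)))))

  ¬q≢0 : ¬ (q ≢ 0ℚ)
  ¬q≢0 q≢0 = unbounded
    (λ ↥≡0 → q≢0 (ℚ.neg-injective (ℚ.↥p≡0⇒p≡0 (ℚ.- q) ↥≡0)))
    -- Denominators are positive by construction, so `b` and `d` cannot be zero.
    (λ ()) (λ ()) K (d ℕ.* (x ℕ.* x) ℕ.* 2) (b ℕ.* (x ℕ.* x)) R-bound

theorem3 : (r : ℂ) (q : ℚ) → q ≢ 0ℚ → r ^ 2 ≈ ℚ→ℂ q → Irrational (cos r)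
theorem3 r q q≢0 r²≈q (p , cos≈p) = ¬q≢0 {r} {q} {p} (≈⇒⇢ᶜ r²≈q) (≈⇒⇢ᶜ cos≈p) q≢0
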